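{- Let $k\ge 3$ be an integer with $k\equiv 1$ or $3\pmod 6$. For every $\delta>0$ there exist $\epsilon>0$ and $n_0$ such that the following holds for all $n\ge n_0$. Suppose that $\mathcal{H}$ is a cancellative $3$-graph on $n$ vertices with \[ |\partial\mathcal{H}|\ge (1-\epsilon)\frac{k-1}{2k}n^2 \quad\text{and}\quad |\mathcal{H}|\ge(1-\epsilon)\frac{k-1}{6k^2}n^3 . \] Then there is $\mathcal{S}\in\mathrm{STS}(k)$ such that $\mathcal{H}$ becomes $\mathcal{S}$-colorable after removing at most $\delta n^3$ edges.
   Context: A $3$-graph $\mathcal{H}$ is cancellative if it contains no three distinct edges $A,B,C$ with $A\triangle B\subseteq C$. $\partial\mathcal{H}=\{A:|A|=2,\ A\subset B\text{ for some } B\in\mathcal{H}\}$. A Steiner triple system on $k$ vertices is a $3$-graph on $k$ vertices in which every pair of vertices lies in exactly one edge; $\mathrm{STS}(k)$ is the family of all of them. $\mathcal{H}$ is $\mathcal{S}$-colorable if there is a map $\phi:V(\mathcal{H})\to V(\mathcal{S})$ with $\phi(E)\in\mathcal{S}$ for all $E\in\mathcal{H}$. -}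

module Defs where

open import Data.Nat as ℕ using (ℕ; zero; suc)
open import Data.Integer using (+_)
open import Data.Rational using (ℚ; _/_)
open import Data.Fin using (Fin)
open import Data.Fin.Subset using (Subset; inside; outside; _∈_; _⊆_; _∪_; _∩_; ∁; ∣_∣)
open import Data.Fin.Subset.Properties using (_⊆?_)
open import Data.Vec using (_∷_; [])
open import Data.List using (List; []; _∷_; _++_; map; filter; length)
open import Data.List.Membership.Propositional renaming (_∈_ to _∈ₗ_)
open import Data.List.Relation.Unary.All using (All)
open import Data.List.Relation.Unary.Any using (any?)
open import Data.List.Relation.Unary.Unique.Propositional using (Unique)
open import Data.Product using (Σ; ∃; _×_; _,_)
open import Function.Bundles using (_⇔_)
open import Relation.Binary.PropositionalEquality using (_≡_; _≢_)
open import Relation.Nullary using (¬_)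
open import Relation.Nullary.Decidable using (_×-dec_)

ℕ→ℚ : ℕ → ℚ
ℕ→ℚ m = + m / 1

_△_ : ∀ {n} → Subset n → Subset n → Subset n
A △ B = (A ∪ B) ∩ ∁ (A ∩ B)

record Graph3 (n : ℕ) : Set where
  field
    edges   : List (Subset n)
    unique  : Unique edges
    uniform : All (λ e → ∣ e ∣ ≡ 3) edges
open Graph3 public

size : ∀ {n} → Graph3 n → ℕ
size H = length (edges H)

Cancellative : ∀ {n} → Graph3 n → Set
Cancellative H = ∀ A B C → A ∈ₗ edges H → B ∈ₗ edges H → C ∈ₗ edges H →
  A ≢ B → B ≢ C → A ≢ C → ¬ ((A △ B) ⊆ C)

allSubsets : (n : ℕ) → List (Subset n)
allSubsets zero = [] ∷ []
allSubsets (suc n) = map (outside ∷_) (allSubsets n) ++ map (inside ∷_) (allSubsets n)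

shadow : ∀ {n} → Graph3 n → List (Subset n)
shadow {n} H = filter (λ A → (∣ A ∣ ℕ.≟ 2) ×-dec any? (λ B → A ⊆? B) (edges H)) (allSubsets n)

shadowSize : ∀ {n} → Graph3 n → ℕ
shadowSize H = length (shadow H)

IsSTS : ∀ {k} → Graph3 k → Set
IsSTS {k} S = ∀ (P : Subset k) → ∣ P ∣ ≡ 2 →
  Σ (Subset k) λ E → E ∈ₗ edges S × P ⊆ E ×
    (∀ E′ → E′ ∈ₗ edges S → P ⊆ E′ → E′ ≡ E)

IsImage : ∀ {n k} → (Fin n → Fin k) → Subset n → Subset k → Set
IsImage φ E F = ∀ j → (j ∈ F) ⇔ (∃ λ i → i ∈ E × φ i ≡ j)

Colorable : ∀ {n k} → Graph3 n → Graph3 k → Set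
Colorable H S = ∃ λ φ → ∀ E → E ∈ₗ edges H → Σ _ λ F → F ∈ₗ edges S × IsImage φ E F

SubGraph : ∀ {n} → Graph3 n → Graph3 n → Set
SubGraph H′ H = ∀ E → E ∈ₗ edges H′ → E ∈ₗ edges H

{-# OPTIONS --safe #-}
module Submission where

-- Write N(uv) for the set of w such that uvw is an edge and f(w) for the number of vertices
-- not adjacent to w in the shadow. Cancellativity makes N(uv) independent in the shadow, so
-- |N(uv)| ≤ f(w) for every edge uvw. Summing this over the link of each vertex gives
-- 6|H| ≤ ∑ (n - f(v)) f(v). Under the two density assumptions this is nearly an equality, so
-- f(v) is about n/k for almost all v, and |N(uv)| is about n/k for almost all shadow pairs.
-- Hence non-adjacency is, up to small errors, an equivalence relation on the typical vertices,
-- with exactly k classes of size about n/k. An edge all of whose vertices are typical and all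
-- of whose pairs have large codegree meets three classes; N(uv) is almost a whole class, and
-- moving one vertex at a time inside its class shows that the classes of u and v determine
-- that of w. These triples of classes form a Steiner triple system, and the other edges are few.

open import Defs
open import Data.Bool using (if_then_else_)
open import Data.Empty using (⊥; ⊥-elim)
open import Data.Fin using (Fin; zero; suc; toℕ; fromℕ<)
import Data.Fin.Properties as Fin
open import Data.Fin.Subset using (Subset; inside; outside; _∈_; _∉_; _⊆_; _∪_; _∩_; ∁; ∣_∣; ⁅_⁆)
open import Data.Fin.Subset.Properties using
  (_∈?_; _⊆?_; ⊆-antisym; x∈p∪q⁺; x∈p∪q⁻; x∈p∩q⁺; x∈p∩q⁻; x∈⁅x⁆; x∈⁅y⁆⇒x≡y; x∈∁p⇒x∉p)
open import Data.List as List using (List; []; _∷_; length; filter)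
open import Data.Nat using (ℕ; zero; suc; z≤n; s≤s; _≥_; _∸_; _%_; _^_; NonZero; >-nonZero)
open import Data.Nat as ℕ using ()
open import Data.Product using (Σ; ∃; ∃₂; _×_; _,_; proj₁; proj₂)
open import Data.Sum as Sum using (_⊎_; inj₁; inj₂; [_,_]′)
open import Data.Unit using (tt)
open import Function using (_∘_)
open import Function.Bundles using (mk⇔)
open import Relation.Binary.PropositionalEquality using
  (_≡_; _≢_; refl; sym; trans; cong; cong₂; subst; subst₂; module ≡-Reasoning)
open import Relation.Nullary using (¬_; Dec; yes; no; does)
open import Relation.Nullary.Decidable using (_×-dec_; _⊎-dec_; ¬?; decidable-stable; toSum)

-- The near-equality is a variance estimate. Let `F` be the sum of all f(v), so that n² - `F` counts
-- the ordered shadow pairs. Expand ∑ (k f(v) - n)² and bound ∑ f(v)² by the edge inequality: `F`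
-- remains with the factor k(k - 2)n, which is not negative, so the lower bound on the shadow, read
-- as an upper bound on `F`, may be inserted. All terms of order n³ without ε cancel, and at most
-- ε(k - 1)²n³ is left.
--
-- The obstacle is that non-adjacency is only approximately transitive. Typical vertices are
-- therefore compared by their sets of non-neighbours and related when these share half of the
-- expected n/k. Sharing half turns out to force sharing almost all, so this relation is exactly
-- transitive.
--
-- There are two error scales: `b` for the deviations of f, and `c`, a constant multiple of `b`, for
-- exceptional sets and defects of codegrees. The total defect of the shadow pairs is of order b n²;
-- averaging it over pairs and then over vertices costs a constant factor, which `c` provides.

module Combinatorics where
  open import Data.Nat using (_+_; _*_; _/_; _≤_; _<_; _≤?_; ∣_-_∣)
  open import Data.Nat.Properties
  open import Data.Nat.DivMod
  open import Data.Nat.Tactic.RingSolver using (solve-∀; solve)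
  open import Algebra.Properties.Semiring.Sum +-*-semiring using
    (sum; sum-cong-≗; ∑-distrib-+; ∑-comm; *-distribˡ-sum; *-distribʳ-sum)

  -- Sums and counts over Fin n

  -- Linear inequalities are proved by certificates: a nonnegative combination x ≤ y
  -- of the hypotheses, a slack s, and a semiring identity.
  by-cert : ∀ {L R x y} s → x ≤ y → L + y + s ≡ R + x → L ≤ R
  by-cert {L} {R} {x} {y} s x≤y eq = +-cancelʳ-≤ y L R
    (≤-trans (m≤m+n (L + y) s) (≤-trans (≤-reflexive eq) (+-monoʳ-≤ R x≤y)))

  infixl 6 _⊞_
  _⊞_ : ∀ {x y u v} → x ≤ y → u ≤ v → x + u ≤ y + v
  _⊞_ = +-mono-≤

  infixr 7 _⊠_
  _⊠_ : ∀ {x y} c → x ≤ y → c * x ≤ c * y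
  c ⊠ p = *-monoʳ-≤ c p

  opaque
    ∑ : ∀ {n} → (Fin n → ℕ) → ℕ
    ∑ = sum

    ∑-zero : (f : Fin 0 → ℕ) → ∑ f ≡ 0
    ∑-zero f = refl

    ∑-suc : ∀ {n} (f : Fin (suc n) → ℕ) → ∑ f ≡ f zero + ∑ (f ∘ suc)
    ∑-suc f = refl

    ∑-cong : ∀ {n} {f g : Fin n → ℕ} → (∀ i → f i ≡ g i) → ∑ f ≡ ∑ g
    ∑-cong = sum-cong-≗

    ∑-+ : ∀ {n} (f g : Fin n → ℕ) → ∑ (λ i → f i + g i) ≡ ∑ f + ∑ g
    ∑-+ = ∑-distrib-+

    ∑-*ˡ : ∀ {n} c (f : Fin n → ℕ) → c * ∑ f ≡ ∑ (λ i → c * f i)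
    ∑-*ˡ = *-distribˡ-sum

    ∑-*ʳ : ∀ {n} c (f : Fin n → ℕ) → ∑ f * c ≡ ∑ (λ i → f i * c)
    ∑-*ʳ = *-distribʳ-sum

    ∑-swap : ∀ {m n} (f : Fin m → Fin n → ℕ) → ∑ (λ i → ∑ (f i)) ≡ ∑ (λ j → ∑ λ i → f i j)
    ∑-swap = ∑-comm

    ∑-mono : ∀ {n} {f g : Fin n → ℕ} → (∀ i → f i ≤ g i) → ∑ f ≤ ∑ g
    ∑-mono {zero}  p = z≤n
    ∑-mono {suc n} p = p zero ⊞ ∑-mono (p ∘ suc)

    ∑-const : ∀ n c → ∑ {n} (λ _ → c) ≡ n * c
    ∑-const zero    c = refl
    ∑-const (suc n) c = cong (c +_) (∑-const n c)

  ∑-≤-+ : ∀ {n} {f g h : Fin n → ℕ} → (∀ i → f i ≤ g i + h i) → ∑ f ≤ ∑ g + ∑ h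
  ∑-≤-+ p = ≤-trans (∑-mono p) (≤-reflexive (∑-+ _ _))

  ∑-+-≤ : ∀ {n} {f g h : Fin n → ℕ} → (∀ i → g i + h i ≤ f i) → ∑ g + ∑ h ≤ ∑ f
  ∑-+-≤ p = ≤-trans (≤-reflexive (sym (∑-+ _ _))) (∑-mono p)

  𝟙 : {P : Set} → Dec P → ℕ
  𝟙 p = if does p then 1 else 0

  𝟙-yes : {P : Set} (p : Dec P) → P → 𝟙 p ≡ 1
  𝟙-yes (yes _) _ = refl
  𝟙-yes (no ¬p) p = ⊥-elim (¬p p)

  𝟙-no : {P : Set} (p : Dec P) → ¬ P → 𝟙 p ≡ 0
  𝟙-no (yes p) ¬p = ⊥-elim (¬p p)
  𝟙-no (no _)  _  = refl

  𝟙-mono : {P Q : Set} (p : Dec P) (q : Dec Q) → (P → Q) → 𝟙 p ≤ 𝟙 q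
  𝟙-mono (no _)  q f = z≤n
  𝟙-mono (yes p) q f = ≤-reflexive (sym (𝟙-yes q (f p)))

  𝟙≤1 : {P : Set} (p : Dec P) → 𝟙 p ≤ 1
  𝟙≤1 (yes _) = ≤-refl
  𝟙≤1 (no _)  = z≤n

  𝟙-cover : {P Q R : Set} (p : Dec P) (q : Dec Q) (r : Dec R) → (P → Q ⊎ R) → 𝟙 p ≤ 𝟙 q + 𝟙 r
  𝟙-cover (no _)  q r f = z≤n
  𝟙-cover (yes p) q r f with f p
  ... | inj₁ q′ = ≤-trans (≤-reflexive (sym (𝟙-yes q q′))) (m≤m+n _ _)
  ... | inj₂ r′ = ≤-trans (≤-reflexive (sym (𝟙-yes r r′))) (m≤n+m _ _)

  𝟙-disjoint : {P Q R : Set} (p : Dec P) (q : Dec Q) (r : Dec R) →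
    (P → R) → (Q → R) → (P → Q → ⊥) → 𝟙 p + 𝟙 q ≤ 𝟙 r
  𝟙-disjoint (no _)  q r f g d = 𝟙-mono q r g
  𝟙-disjoint (yes p) q r f g d rewrite 𝟙-no q (d p) = ≤-reflexive (sym (𝟙-yes r (f p)))

  𝟙-*-≤ : {P : Set} (p : Dec P) {c x : ℕ} → (P → c ≤ x) → 𝟙 p * c ≤ x
  𝟙-*-≤ (no _)  f = z≤n
  𝟙-*-≤ (yes p) f = ≤-trans (≤-reflexive (*-identityˡ _)) (f p)

  𝟙-⊎ : {P Q : Set} (p : Dec P) (q : Dec Q) → 𝟙 (p ⊎-dec q) ≤ 𝟙 p + 𝟙 q
  𝟙-⊎ p q = 𝟙-cover (p ⊎-dec q) p q λ x → x

  𝟙-¬-+ : {P : Set} (p : Dec P) {x : ℕ} → (P → 1 ≤ x) → 1 ≤ x + 𝟙 (¬? p)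
  𝟙-¬-+ (yes p) {x} f = ≤-trans (f p) (m≤m+n x 0)
  𝟙-¬-+ (no _)  {x} f = m≤n+m 1 x

  # : ∀ {n} {P : Fin n → Set} → (∀ i → Dec (P i)) → ℕ
  # P? = ∑ (λ i → 𝟙 (P? i))

  #-mono : ∀ {n} {P Q : Fin n → Set} (P? : ∀ i → Dec (P i)) (Q? : ∀ i → Dec (Q i)) →
    (∀ i → P i → Q i) → # P? ≤ # Q?
  #-mono P? Q? f = ∑-mono λ i → 𝟙-mono (P? i) (Q? i) (f i)

  module _ {n : ℕ} {P Q R : Fin n → Set} where
    #-cover : (P? : ∀ i → Dec (P i)) (Q? : ∀ i → Dec (Q i)) (R? : ∀ i → Dec (R i)) →
      (∀ i → P i → Q i ⊎ R i) → # P? ≤ # Q? + # R?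
    #-cover P? Q? R? f = ∑-≤-+ λ i → 𝟙-cover (P? i) (Q? i) (R? i) (f i)

    #-disjoint : (P? : ∀ i → Dec (P i)) (Q? : ∀ i → Dec (Q i)) (R? : ∀ i → Dec (R i)) →
      (∀ i → P i → R i) → (∀ i → Q i → R i) → (∀ i → P i → Q i → ⊥) → # P? + # Q? ≤ # R?
    #-disjoint P? Q? R? f g d = ∑-+-≤ λ i → 𝟙-disjoint (P? i) (Q? i) (R? i) (f i) (g i) (d i)

    #-inclusion-exclusion : (P? : ∀ i → Dec (P i)) (Q? : ∀ i → Dec (Q i)) (R? : ∀ i → Dec (R i)) →
      (∀ i → P i → R i) → (∀ i → Q i → R i) → # P? + # Q? ≤ # R? + # (λ i → P? i ×-dec Q? i)
    #-inclusion-exclusion P? Q? R? f g =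
      ≤-trans (∑-+-≤ pt) (≤-reflexive (∑-+ _ _))
      where
      pt : ∀ i → 𝟙 (P? i) + 𝟙 (Q? i) ≤ 𝟙 (R? i) + 𝟙 (P? i ×-dec Q? i)
      pt i with P? i | Q? i
      ... | no _  | q     = ≤-trans (𝟙-mono q (R? i) (g i)) (m≤m+n _ _)
      ... | yes p | no _  = ≤-trans (≤-reflexive (sym (𝟙-yes (R? i) (f i p)))) (m≤m+n _ _)
      ... | yes p | yes _ rewrite 𝟙-yes (R? i) (f i p) = ≤-refl

  #-⊎ : ∀ {n} {P Q : Fin n → Set} (P? : ∀ i → Dec (P i)) (Q? : ∀ i → Dec (Q i)) →
    # (λ i → P? i ⊎-dec Q? i) ≤ # P? + # Q?
  #-⊎ P? Q? = #-cover (λ i → P? i ⊎-dec Q? i) P? Q? λ _ x → x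

  pick : ∀ {n} {P Q : Fin n → Set} (P? : ∀ i → Dec (P i)) (Q? : ∀ i → Dec (Q i)) →
    # Q? < # P? → ∃ λ i → P i × ¬ Q i
  pick P? Q? lt with Fin.any? (λ i → P? i ×-dec ¬? (Q? i))
  ... | yes x  = x
  ... | no ¬x = ⊥-elim (<⇒≱ lt (#-mono P? Q? λ i p → decidable-stable (Q? i) λ ¬q → ¬x (i , p , ¬q)))

  #-insert : ∀ {n} {P Q : Fin n → Set} (P? : ∀ i → Dec (P i)) (Q? : ∀ i → Dec (Q i)) (x : Fin n) →
    P x → ¬ Q x → (∀ i → Q i → P i) → suc (# Q?) ≤ # P?
  #-insert P? Q? zero p ¬q f
    rewrite ∑-suc (λ i → 𝟙 (P? i)) | ∑-suc (λ i → 𝟙 (Q? i)) | 𝟙-yes (P? zero) p | 𝟙-no (Q? zero) ¬q =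
    s≤s (#-mono (Q? ∘ suc) (P? ∘ suc) (f ∘ suc))
  #-insert P? Q? (suc x) p ¬q f
    rewrite ∑-suc (λ i → 𝟙 (P? i)) | ∑-suc (λ i → 𝟙 (Q? i)) =
    ≤-trans (≤-reflexive (sym (+-suc _ _)))
      (𝟙-mono (Q? zero) (P? zero) (f zero) ⊞ #-insert (P? ∘ suc) (Q? ∘ suc) x p ¬q (f ∘ suc))

  #-none : ∀ {n} {P : Fin n → Set} (P? : ∀ i → Dec (P i)) → (∀ i → ¬ P i) → # P? ≡ 0
  #-none {n} P? f = trans (∑-cong λ i → 𝟙-no (P? i) (f i)) (trans (∑-const n 0) (*-zeroʳ n))

  #-all : ∀ {n} {P : Fin n → Set} (P? : ∀ i → Dec (P i)) → (∀ i → P i) → # P? ≡ n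
  #-all {n} P? f = trans (∑-cong λ i → 𝟙-yes (P? i) (f i)) (trans (∑-const n 1) (*-identityʳ n))

  #-subsingleton : ∀ {n} {P : Fin n → Set} (P? : ∀ i → Dec (P i)) →
    (∀ i j → P i → P j → i ≡ j) → # P? ≤ 1
  #-subsingleton {zero}  P? u rewrite ∑-zero (λ i → 𝟙 (P? i)) = z≤n
  #-subsingleton {suc n} {P} P? u rewrite ∑-suc (λ i → 𝟙 (P? i)) with P? zero
  ... | yes p = s≤s (≤-reflexive (#-none (P? ∘ suc) λ i q → Fin.0≢1+n (u zero (suc i) p q)))
  ... | no _  = #-subsingleton (P? ∘ suc) λ i j p q → Fin.suc-injective (u (suc i) (suc j) p q)

  markov : ∀ {n} (f : Fin n → ℕ) c → # (λ i → suc c ≤? f i) * suc c ≤ ∑ f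
  markov f c = ≤-trans (≤-reflexive (∑-*ʳ (suc c) _)) (∑-mono λ i → 𝟙-*-≤ (suc c ≤? f i) λ p → p)

  pick₂ : ∀ {n} {P Q R : Fin n → Set}
    (P? : ∀ i → Dec (P i)) (Q? : ∀ i → Dec (Q i)) (R? : ∀ i → Dec (R i)) →
    # Q? + # R? < # P? → ∃ λ i → P i × ¬ Q i × ¬ R i
  pick₂ P? Q? R? lt with pick P? (λ i → Q? i ⊎-dec R? i) (≤-trans (s≤s (#-⊎ Q? R?)) lt)
  ... | i , p , ¬qr = i , p , ¬qr ∘ inj₁ , ¬qr ∘ inj₂

  pick₃ : ∀ {n} {P Q R S : Fin n → Set}
    (P? : ∀ i → Dec (P i)) (Q? : ∀ i → Dec (Q i)) (R? : ∀ i → Dec (R i)) (S? : ∀ i → Dec (S i)) →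
    # Q? + # R? + # S? < # P? → ∃ λ i → P i × ¬ Q i × ¬ R i × ¬ S i
  pick₃ P? Q? R? S? lt
    with pick₂ P? (λ i → Q? i ⊎-dec R? i) S? (≤-trans (s≤s (+-monoˡ-≤ _ (#-⊎ Q? R?))) lt)
  ... | i , p , ¬qr , ¬s = i , p , ¬qr ∘ inj₁ , ¬qr ∘ inj₂ , ¬s

  ≤-𝟙-* : {P : Set} (p : Dec P) {c x : ℕ} → (¬ P → x ≤ 0) → (P → x ≤ c) → x ≤ 𝟙 p * c
  ≤-𝟙-* (yes p) f g = ≤-trans (g p) (≤-reflexive (sym (*-identityˡ _)))
  ≤-𝟙-* (no ¬p) f g = f ¬p

  ∑-bound : ∀ {n} {f : Fin n → ℕ} c → (∀ i → f i ≤ c) → ∑ f ≤ n * c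
  ∑-bound {n} c p = ≤-trans (∑-mono p) (≤-reflexive (∑-const n c))

  #-inhabited : ∀ {n} {P : Fin n → Set} (P? : ∀ i → Dec (P i)) i → P i → 1 ≤ # P?
  #-inhabited P? i p = ≤-trans (s≤s z≤n) (#-insert {Q = λ _ → ⊥} P? (λ _ → no λ ()) i p (λ ()) λ _ ())

  ∑³ : ∀ {n} → (Fin n → Fin n → Fin n → ℕ) → ℕ
  ∑³ f = ∑ λ x → ∑ λ y → ∑ λ z → f x y z

  ∑³-mono : ∀ {n} {f g : Fin n → Fin n → Fin n → ℕ} → (∀ x y z → f x y z ≤ g x y z) → ∑³ f ≤ ∑³ g
  ∑³-mono p = ∑-mono λ x → ∑-mono λ y → ∑-mono λ z → p x y z

  ∑³-+ : ∀ {n} (f g : Fin n → Fin n → Fin n → ℕ) → ∑³ (λ x y z → f x y z + g x y z) ≡ ∑³ f + ∑³ g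
  ∑³-+ f g = trans (∑-cong λ x → trans (∑-cong λ y → ∑-+ _ _) (∑-+ _ _)) (∑-+ _ _)

  ∑³-rotate : ∀ {n} (f : Fin n → Fin n → Fin n → ℕ) → ∑³ f ≡ ∑³ (λ y z x → f x y z)
  ∑³-rotate f = trans (∑-swap λ x y → ∑ (f x y)) (∑-cong λ y → ∑-swap λ x z → f x y z)

  #≤n : ∀ {n} {P : Fin n → Set} (P? : ∀ i → Dec (P i)) → # P? ≤ n
  #≤n {n} P? = ≤-trans (∑-bound 1 λ i → 𝟙≤1 (P? i)) (≤-reflexive (*-identityʳ n))

  -- The parts of a near-extremal system of triples

  module Bounds (a c : ℕ) (60c≤a : 60 * c ≤ a) (1≤c : 1 ≤ c) where
    full-neighbour : ∀ {n m b o} → 2 * a ≤ n → m ≤ a + c → b ≤ c → o ≤ c → suc (m + b + o) ≤ n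
    full-neighbour {n} {m} {b} {o} h₁ h₂ h₃ h₄ = by-cert (56 * c)
      (h₁ ⊞ h₂ ⊞ h₃ ⊞ h₄ ⊞ 60c≤a ⊞ 1≤c)
      (solve (a ∷ n ∷ m ∷ c ∷ b ∷ o ∷ []))

    bad<full : ∀ {b d} → b ≤ c → a ≤ d + c → suc b ≤ d
    bad<full {b} {d} h₁ h₂ = by-cert (57 * c)
      (h₁ ⊞ h₂ ⊞ 60c≤a ⊞ 1≤c)
      (solve (b ∷ c ∷ a ∷ d ∷ []))

    full⇒large : ∀ {d e} → a ≤ d + c → d ≤ e → a ≤ 2 * e
    full⇒large {d} {e} h₁ h₂ = by-cert (58 * c)
      (2 ⊠ h₁ ⊞ 2 ⊠ h₂ ⊞ 60c≤a)
      (solve (a ∷ d ∷ c ∷ e ∷ []))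

    full-pairs-meet : ∀ {o D X A B i i′} → o ≤ c → a ≤ 2 * D → D ≤ X + (A + B) → A + i ≤ a + c →
      a ≤ i + c → B + i′ ≤ a + c → a ≤ i′ + c → 2 * suc o ≤ 2 * X
    full-pairs-meet {o} {D} {X} {A} {B} {i} {i′} h₁ h₂ h₃ h₄ h₅ h₆ h₇ = by-cert (48 * c)
      (2 ⊠ h₁ ⊞ h₂ ⊞ 2 ⊠ h₃ ⊞ 2 ⊠ h₄ ⊞ 2 ⊠ h₅ ⊞ 2 ⊠ h₆ ⊞ 2 ⊠ h₇ ⊞ 60c≤a ⊞ 2 ⊠ 1≤c)
      (solve (o ∷ c ∷ a ∷ D ∷ X ∷ A ∷ B ∷ i ∷ i′ ∷ []))

    union-bound : ∀ {i i′ m X D} → a ≤ i + c → a ≤ i′ + c → i + i′ ≤ m + X → m ≤ a + c → X ≤ D →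
      a ≤ D + 3 * c
    union-bound {i} {i′} {m} {X} {D} h₁ h₂ h₃ h₄ h₅ = by-cert 0
      (h₁ ⊞ h₂ ⊞ h₃ ⊞ h₄ ⊞ h₅)
      (solve (a ∷ i ∷ c ∷ i′ ∷ m ∷ X ∷ D ∷ []))

    large-trans : ∀ {D D′ m E} → a ≤ D + 3 * c → a ≤ D′ + 3 * c → D + D′ ≤ m + E → m ≤ a + c →
      a ≤ 2 * E
    large-trans {D} {D′} {m} {E} h₁ h₂ h₃ h₄ = by-cert (46 * c)
      (2 ⊠ h₁ ⊞ 2 ⊠ h₂ ⊞ 2 ⊠ h₃ ⊞ 2 ⊠ h₄ ⊞ 60c≤a)
      (solve (a ∷ D ∷ c ∷ D′ ∷ m ∷ E ∷ []))

    part-lower : ∀ {d s o} → a ≤ d + c → d ≤ s + o → o ≤ c → a ≤ s + 2 * c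
    part-lower {d} {s} {o} h₁ h₂ h₃ = by-cert 0
      (h₁ ⊞ h₂ ⊞ h₃)
      (solve (a ∷ d ∷ c ∷ s ∷ o ∷ []))

    part-degree : ∀ {p D X o} → p + 4 * c ≤ a → a ≤ D + 3 * c → D ≤ X + o → o ≤ c → p ≤ X
    part-degree {p} {D} {X} {o} h₁ h₂ h₃ h₄ = by-cert 0
      (h₁ ⊞ h₂ ⊞ h₃ ⊞ h₄)
      (solve (p ∷ c ∷ a ∷ D ∷ X ∷ o ∷ []))

    -- Here p = a - 4c bounds from below the typical common non-neighbours of two related vertices.
    -- The square is p² + 10cp + 25c², and 25c² is at most cp, which gives the factor p + 11c = a +
    -- 7c.
    part-upper : ∀ {t p} → t * p ≤ (p + 5 * c) * (p + 5 * c) → 56 * c ≤ p →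
      t * p ≤ (p + 11 * c) * p
    part-upper {t} {p} h₁ h₂ = by-cert (31 * c * c)
      (h₁ ⊞ c ⊠ h₂)
      (solve (t ∷ p ∷ c ∷ []))

    part∖full : ∀ {s t u d o} → s + t ≤ u → u ≤ a + 7 * c → d ≤ t + o → o ≤ c → a ≤ d + c →
      s ≤ 9 * c
    part∖full {s} {t} {u} {d} {o} h₁ h₂ h₃ h₄ h₅ = by-cert 0
      (h₁ ⊞ h₂ ⊞ h₃ ⊞ h₄ ⊞ h₅)
      (solve (s ∷ t ∷ u ∷ a ∷ c ∷ d ∷ o ∷ []))

    non-neighbours∖part : ∀ {s t m d o} → s + t ≤ m → m ≤ a + c → d ≤ t + o → o ≤ c → a ≤ d + c →
      s ≤ 3 * c
    non-neighbours∖part {s} {t} {m} {d} {o} h₁ h₂ h₃ h₄ h₅ = by-cert 0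
      (h₁ ⊞ h₂ ⊞ h₃ ⊞ h₄ ⊞ h₅)
      (solve (s ∷ t ∷ m ∷ a ∷ c ∷ d ∷ o ∷ []))

    no-inner-pair : ∀ {d s o} → a ≤ d + c → d ≤ s + o → s ≤ 9 * c → o ≤ c → suc a ≤ a
    no-inner-pair {d} {s} {o} h₁ h₂ h₃ h₄ = by-cert (48 * c)
      (h₁ ⊞ h₂ ⊞ h₃ ⊞ h₄ ⊞ 60c≤a ⊞ 1≤c)
      (solve (a ∷ d ∷ c ∷ s ∷ o ∷ []))

    row-exceptions : ∀ {X A B C} → X ≤ A + (B + C) → A ≤ 9 * c → B ≤ c → C ≤ c → X ≤ 11 * c
    row-exceptions {X} {A} {B} {C} h₁ h₂ h₃ h₄ = by-cert 0
      (h₁ ⊞ h₂ ⊞ h₃ ⊞ h₄)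
      (solve (X ∷ A ∷ B ∷ C ∷ c ∷ []))

    avoid-rows : ∀ {A B s} → A ≤ 11 * c → B ≤ 11 * c → a ≤ s + 2 * c → suc (A + B) ≤ s
    avoid-rows {A} {B} {s} h₁ h₂ h₃ = by-cert (35 * c)
      (h₁ ⊞ h₂ ⊞ h₃ ⊞ 60c≤a ⊞ 1≤c)
      (solve (A ∷ c ∷ B ∷ a ∷ s ∷ []))

    avoid-part : ∀ {A B s} → A ≤ 3 * c → B ≤ c → a ≤ s + 2 * c → suc (A + B) ≤ s
    avoid-part {A} {B} {s} h₁ h₂ h₃ = by-cert (53 * c)
      (h₁ ⊞ h₂ ⊞ h₃ ⊞ 60c≤a ⊞ 1≤c)
      (solve (A ∷ c ∷ B ∷ a ∷ s ∷ []))

    avoid-bad : ∀ {o b b′ d} → o ≤ c → b ≤ c → b′ ≤ c → a ≤ d + c → suc (o + b + b′) ≤ d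
    avoid-bad {o} {b} {b′} {d} h₁ h₂ h₃ h₄ = by-cert (55 * c)
      (h₁ ⊞ h₂ ⊞ h₃ ⊞ h₄ ⊞ 60c≤a ⊞ 1≤c)
      (solve (o ∷ c ∷ b ∷ b′ ∷ a ∷ d ∷ []))

    too-few-parts : ∀ {n m k} → n ≤ m * (a + 7 * c) + c → k * a ≤ n → suc m ≤ k →
      30 * (k * c) ≤ a → suc a ≤ a
    too-few-parts {n} {m} {k} h₁ h₂ h₃ h₄ = by-cert (28 * c + 23 * c * m)
      (h₁ ⊞ h₂ ⊞ (a + 30 * c) ⊠ h₃ ⊞ h₄ ⊞ 1≤c)
      (solve (n ∷ m ∷ a ∷ c ∷ k ∷ []))

    too-many-parts : ∀ {k n} → suc k * a ≤ n + suc k * (2 * c) → n ≤ k * a + c →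
      30 * (k * c) ≤ a → 2 ≤ k → suc a ≤ a
    too-many-parts {k} {n} h₁ h₂ h₃ h₄ = by-cert (26 * c * k)
      (h₁ ⊞ h₂ ⊞ h₃ ⊞ (2 * c) ⊠ h₄ ⊞ 1≤c)
      (solve (k ∷ a ∷ n ∷ c ∷ []))

  -- W consists of the typical vertices: about n/k non-neighbours and few deficient shadow
  -- pairs. The parameter a is n/k rounded down, and c bounds every error term.
  module Structure {n : ℕ}
    (h : Fin n → Fin n → Fin n → Set) (h? : ∀ x y z → Dec (h x y z))
    (G : Fin n → Fin n → Set) (G? : ∀ x y → Dec (G x y))
    (W : Fin n → Set) (W? : ∀ x → Dec (W x))
    (h-rotate : ∀ {x y z} → h x y z → h y z x)
    (h-swap : ∀ {x y z} → h x y z → h y x z)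
    (h⇒G : ∀ {x y z} → h x y z → G x y)
    (G-sym : ∀ {x y} → G x y → G y x)
    (independent : ∀ {u v w w′} → h u v w → h u v w′ → ¬ G w w′)
    (k a c : ℕ) (2≤k : 2 ≤ k) (1≤c : 1 ≤ c) (30kc≤a : 30 * (k * c) ≤ a) (ka≤n : k * a ≤ n) (n≤ka+c : n ≤ k * a + c)
    (#W-small : # (λ x → ¬? (W? x)) ≤ c)
    (#M-small : ∀ {x} → W x → # (λ y → ¬? (G? x y)) ≤ a + c)
    (#bad-small : ∀ {x} → W x → # (λ y → G? x y ×-dec ¬? (a ≤? # (h? x y) + c)) ≤ c)
    where

    -- The non-neighbours of x; for most x they approximate the part of x.
    M : Fin n → Fin n → Set
    M x y = ¬ G x y

    M? : ∀ x y → Dec (M x y)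
    M? x y = ¬? (G? x y)

    ∁W? : ∀ x → Dec (¬ W x)
    ∁W? x = ¬? (W? x)

    Full : Fin n → Fin n → Set
    Full x y = a ≤ # (h? x y) + c

    Full? : ∀ x y → Dec (Full x y)
    Full? x y = a ≤? # (h? x y) + c

    Bad : Fin n → Fin n → Set
    Bad x y = G x y × ¬ Full x y

    Bad? : ∀ x y → Dec (Bad x y)
    Bad? x y = G? x y ×-dec ¬? (Full? x y)

    Full-sym : ∀ {x y} → Full x y → Full y x
    Full-sym {x} {y} p = ≤-trans p (+-monoˡ-≤ c (#-mono (h? x y) (h? y x) λ _ → h-swap))

    full : ∀ {x y} → G x y → ¬ Bad x y → Full x y
    full {x} {y} g ¬b = decidable-stable (Full? x y) λ ¬f → ¬b (g , ¬f)

    h-swap₂ : ∀ {x y z} → h x y z → h x z y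
    h-swap₂ = h-swap ∘ h-rotate ∘ h-rotate

    h⇒G₂ : ∀ {x y z} → h x y z → G x z
    h⇒G₂ = h⇒G ∘ h-swap₂

    h⇒M : ∀ {u v x} → h u v x → ∀ y → h u v y → M x y
    h⇒M p y q = independent p q

    60c≤a : 60 * c ≤ a
    60c≤a = ≤-trans (≤-reflexive (lemma c)) (≤-trans (30 ⊠ *-monoˡ-≤ c 2≤k) 30kc≤a)
      where
      lemma : ∀ c → 60 * c ≡ 30 * (2 * c)
      lemma = solve-∀

    2a≤n : 2 * a ≤ n
    2a≤n = ≤-trans (*-monoˡ-≤ a 2≤k) ka≤n

    W-stable : ∀ {x} → ¬ ¬ W x → W x
    W-stable {x} = decidable-stable (W? x)

    G-stable : ∀ {x y} → ¬ M x y → G x y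
    G-stable {x} {y} = decidable-stable (G? x y)

    open Bounds a c 60c≤a 1≤c

    -- The edge is built in two steps: a typical neighbour v of w with wv full, then u in N(wv) with
    -- vu not bad. Typicality of v is what makes its bad partners fewer than N(wv).
    in-full-pair : ∀ {w} → W w → ∃₂ λ u v → Full u v × h u v w
    in-full-pair {w} Ww =
      let v , _ , ¬m , ¬b , ¬¬Wv = pick₃ (λ _ → yes tt) (M? w) (Bad? w) ∁W?
            (≤-trans (full-neighbour 2a≤n (#M-small Ww) (#bad-small Ww) #W-small)
              (≤-reflexive (sym (#-all {n} (λ _ → yes tt) λ _ → tt))))
          u , wvu , ¬b′ = pick (h? w v) (Bad? v)
            (bad<full (#bad-small (W-stable ¬¬Wv)) (full (G-stable ¬m) ¬b))
      in v , u , full (h⇒G (h-rotate wvu)) ¬b′ , h-rotate wvu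

    -- Equivalence of typical vertices

    MM? : ∀ x y z → Dec (M x z × M y z)
    MM? x y z = M? x z ×-dec M? y z

    infix 4 _~_ _~?_
    -- Half of `a` is a deliberately weak threshold: easy to reach, and improved to a - 3c by
    -- `~⇒large`.
    _~_ : Fin n → Fin n → Set
    x ~ y = W x × W y × a ≤ 2 * # (MM? x y)

    _~?_ : ∀ x y → Dec (x ~ y)
    x ~? y = W? x ×-dec W? y ×-dec a ≤? 2 * # (MM? x y)

    ~-sym : ∀ {x y} → x ~ y → y ~ x
    ~-sym {x} {y} (Wx , Wy , p) =
      Wy , Wx , ≤-trans p (2 ⊠ #-mono (MM? x y) (MM? y x) λ _ (q , r) → r , q)

    -- Independence puts N(uv) inside both `M x` and `M y`, and a full N(uv) has at least a - c
    -- elements.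
    same-pair⇒~ : ∀ {u v x y} → Full u v → h u v x → h u v y → W x → W y → x ~ y
    same-pair⇒~ {u} {v} {x} {y} F p q Wx Wy = Wx , Wy ,
      full⇒large F (#-mono (h? u v) (MM? x y) λ z r → h⇒M p z r , h⇒M q z r)

    -- N(uv) exhausts `M x` up to 2c elements, and N(u′v′) exhausts `M y` likewise. So of the a/2
    -- common non-neighbours all but 4c lie in both sets, which is more than the number of atypical
    -- vertices.
    full-pairs-common : ∀ {x y u v u′ v′} → x ~ y → Full u v → h u v x → Full u′ v′ → h u′ v′ y →
      ∃ λ z → (h u v z × h u′ v′ z) × ¬ ¬ W z
    full-pairs-common {x} {y} {u} {v} {u′} {v′} (Wx , Wy , x~y) F p F′ p′ = pick NN? ∁W? enough
      where
      NN? : ∀ z → Dec (h u v z × h u′ v′ z)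
      NN? z = h? u v z ×-dec h? u′ v′ z
      A? : ∀ z → Dec (M x z × ¬ h u v z)
      A? z = M? x z ×-dec ¬? (h? u v z)
      B? : ∀ z → Dec (M y z × ¬ h u′ v′ z)
      B? z = M? y z ×-dec ¬? (h? u′ v′ z)
      A-small : # A? + # (h? u v) ≤ a + c
      A-small = ≤-trans (#-disjoint A? (h? u v) (M? x) (λ _ → proj₁) (h⇒M p) (λ _ (_ , ¬q) q → ¬q q)) (#M-small Wx)
      B-small : # B? + # (h? u′ v′) ≤ a + c
      B-small = ≤-trans (#-disjoint B? (h? u′ v′) (M? y) (λ _ → proj₁) (h⇒M p′) (λ _ (_ , ¬q) q → ¬q q)) (#M-small Wy)
      split : ∀ z → M x z × M y z → (h u v z × h u′ v′ z) ⊎ ((M x z × ¬ h u v z) ⊎ (M y z × ¬ h u′ v′ z))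
      split z (mx , my) with h? u v z | h? u′ v′ z
      ... | no ¬q | _     = inj₂ (inj₁ (mx , ¬q))
      ... | yes _ | no ¬q = inj₂ (inj₂ (my , ¬q))
      ... | yes q | yes r = inj₁ (q , r)
      cover : # (MM? x y) ≤ # NN? + (# A? + # B?)
      cover = ≤-trans (#-cover (MM? x y) NN? (λ z → A? z ⊎-dec B? z) split) (+-monoʳ-≤ _ (#-⊎ A? B?))
      enough : suc (# ∁W?) ≤ # NN?
      enough = *-cancelˡ-≤ {_} {# NN?} 2 (full-pairs-meet {X = # NN?} #W-small x~y cover A-small F B-small F′)

    -- This is the jump from half to almost all. A typical z common to two full sets, one around x
    -- and one around y, has both inside `M z`, where only a + c elements fit. They overlap in a -
    -- 3c elements, all of them non-adjacent to x and to y.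
    ~⇒large : ∀ {x y} → x ~ y → a ≤ # (MM? x y) + 3 * c
    ~⇒large {x} {y} x~y@(Wx , Wy , _) =
      let u , v , F , p = in-full-pair Wx
          u′ , v′ , F′ , p′ = in-full-pair Wy
          z , (q , q′) , ¬¬Wz = full-pairs-common x~y F p F′ p′
      in union-bound F F′ (#-inclusion-exclusion (h? u v) (h? u′ v′) (M? z) (h⇒M q) (h⇒M q′))
        (#M-small (W-stable ¬¬Wz))
        (#-mono (λ t → h? u v t ×-dec h? u′ v′ t) (MM? x y) λ t (r , r′) → h⇒M p t r , h⇒M p′ t r′)

    -- Two subsets of `M y` with at least a - 3c elements each overlap in at least a - 7c, still
    -- above half of `a`.
    ~-trans : ∀ {x y z} → x ~ y → y ~ z → x ~ z
    ~-trans {x} {y} {z} p q = proj₁ p , proj₁ (proj₂ q) ,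
      large-trans {# (MM? x y)} {# (MM? y z)} (~⇒large p) (~⇒large q)
        (≤-trans (#-inclusion-exclusion (MM? x y) (MM? y z) (M? y) (λ _ → proj₂) (λ _ → proj₁))
          (+-monoʳ-≤ _ (#-mono (λ t → MM? x y t ×-dec MM? y z t) (MM? x z) λ _ ((r , _) , (_ , s)) → r , s)))
        (#M-small (proj₁ q))

    full⊆part : ∀ {u v w} → Full u v → h u v w → W w → ∀ x → h u v x → w ~ x ⊎ ¬ W x
    full⊆part F p Ww x q with W? x
    ... | yes Wx = inj₁ (same-pair⇒~ F p q Ww Wx)
    ... | no ¬Wx = inj₂ ¬Wx

    full⊆full∩part : ∀ {u v w} → Full u v → h u v w → W w → ∀ x → h u v x → (h u v x × w ~ x) ⊎ ¬ W x
    full⊆full∩part F p Ww x q = Sum.map₁ (q ,_) (full⊆part F p Ww x q)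

    part-large : ∀ {w} → W w → a ≤ # (w ~?_) + 2 * c
    part-large {w} Ww = let u , v , F , p = in-full-pair Ww in
      part-lower F (#-cover (h? u v) (w ~?_) ∁W? (full⊆part F p Ww)) #W-small

    -- Double count the non-adjacent pairs between the part of r and M r.
    part-small : ∀ {r} → W r → # (r ~?_) ≤ a + 7 * c
    part-small {r} Wr = ≤-trans (*-cancelʳ-≤ (# (r ~?_)) (p + 11 * c) p {{>-nonZero 0<p}}
          (part-upper {# (r ~?_)} double 56c≤p))
        (≤-reflexive (trans (lemma p c) (cong (_+ 7 * c) p+4c≡a)))
      where
      p = a ∸ 4 * c
      lemma : ∀ p c → p + 11 * c ≡ p + 4 * c + 7 * c
      lemma = solve-∀
      p+4c≡a : p + 4 * c ≡ a
      p+4c≡a = m∸n+n≡m (≤-trans (*-monoˡ-≤ c {4} {60} (m≤m+n 4 56)) 60c≤a)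
      56c≤p : 56 * c ≤ p
      56c≤p = +-cancelʳ-≤ (4 * c) _ _ (≤-trans (≤-reflexive (sym (*-distribʳ-+ c 56 4)))
        (≤-trans 60c≤a (≤-reflexive (sym p+4c≡a))))
      0<p : 0 < p
      0<p = ≤-trans 1≤c (≤-trans (m≤m+n c (55 * c)) 56c≤p)
      A? : ∀ y → Dec (M r y × W y)
      A? y = M? r y ×-dec W? y
      B? : ∀ w y → Dec ((r ~ w) × (M r y × W y) × M w y)
      B? w y = (r ~? w) ×-dec A? y ×-dec M? w y
      degree : ∀ w → r ~ w → p ≤ # (B? w)
      degree w r~w = part-degree (≤-reflexive p+4c≡a) (~⇒large r~w) (#-cover (MM? r w) (B? w) ∁W? split) #W-small
        where
        split : ∀ y → M r y × M w y → ((r ~ w) × (M r y × W y) × M w y) ⊎ ¬ W y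
        split y (m , m′) with W? y
        ... | yes Wy = inj₁ (r~w , (m , Wy) , m′)
        ... | no ¬Wy = inj₂ ¬Wy
      codegree : ∀ y → # (λ w → B? w y) ≤ 𝟙 (A? y) * (a + c)
      codegree y = ≤-𝟙-* (A? y)
        (λ ¬q → ≤-reflexive (#-none (λ w → B? w y) λ _ (_ , q , _) → ¬q q))
        λ (_ , Wy) → ≤-trans (#-mono (λ w → B? w y) (M? y) λ w (_ , _ , m) g → m (G-sym g)) (#M-small Wy)
      a+c≡p+5c : a + c ≡ p + 5 * c
      a+c≡p+5c = trans (cong (_+ c) (sym p+4c≡a)) (lemma′ p c)
        where
        lemma′ : ∀ p c → p + 4 * c + c ≡ p + 5 * c
        lemma′ = solve-∀
      double : # (r ~?_) * p ≤ (p + 5 * c) * (p + 5 * c)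
      double = begin
        # (r ~?_) * p                       ≡⟨ ∑-*ʳ p _ ⟩
        ∑ (λ w → 𝟙 (r ~? w) * p)            ≤⟨ ∑-mono (λ w → 𝟙-*-≤ (r ~? w) (degree w)) ⟩
        ∑ (λ w → ∑ λ y → 𝟙 (B? w y))        ≡⟨ ∑-swap (λ w y → 𝟙 (B? w y)) ⟩
        ∑ (λ y → ∑ λ w → 𝟙 (B? w y))        ≤⟨ ∑-mono codegree ⟩
        ∑ (λ y → 𝟙 (A? y) * (a + c))        ≡⟨ ∑-*ʳ (a + c) _ ⟨
        # A? * (a + c)                      ≤⟨ *-monoˡ-≤ (a + c) (≤-trans (#-mono A? (M? r) λ _ → proj₁) (#M-small Wr)) ⟩
        (a + c) * (a + c)                   ≡⟨ cong₂ _*_ a+c≡p+5c a+c≡p+5c ⟩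
        (p + 5 * c) * (p + 5 * c)           ∎
        where open ≤-Reasoning

    -- The part has at most a + 7c elements, and the typical members of N(uv), at least a - 2c of
    -- them, belong to it.
    #part∖full : ∀ {u v w} → Full u v → h u v w → W w → # (λ x → (w ~? x) ×-dec ¬? (h? u v x)) ≤ 9 * c
    #part∖full {u} {v} {w} F p Ww = part∖full
      (#-disjoint (λ x → (w ~? x) ×-dec ¬? (h? u v x)) (λ x → h? u v x ×-dec w ~? x) (w ~?_)
        (λ _ → proj₁) (λ _ → proj₂) (λ _ (_ , ¬q) (q , _) → ¬q q))
      (part-small Ww)
      (#-cover (h? u v) (λ x → h? u v x ×-dec w ~? x) ∁W? (full⊆full∩part F p Ww))
      #W-small F

    #part∖M : ∀ {w} → W w → # (λ x → (w ~? x) ×-dec ¬? (M? w x)) ≤ 9 * c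
    #part∖M {w} Ww = let u , v , F , p = in-full-pair Ww in ≤-trans
      (#-mono (λ x → (w ~? x) ×-dec ¬? (M? w x)) (λ x → (w ~? x) ×-dec ¬? (h? u v x))
        λ x (q , ¬m) → q , λ r → ¬m (h⇒M p x r))
      (#part∖full F p Ww)

    -- The typical members of a full N(uv) through w lie in `M w` and in the part of w; there are at
    -- least a - 2c of them, while `M w` has at most a + c elements.
    #M∖part : ∀ {w} → W w → # (λ x → M? w x ×-dec ¬? (w ~? x)) ≤ 3 * c
    #M∖part {w} Ww = let u , v , F , p = in-full-pair Ww in non-neighbours∖part
      (#-disjoint (λ x → M? w x ×-dec ¬? (w ~? x)) (λ x → h? u v x ×-dec w ~? x) (M? w)
        (λ _ → proj₁) (λ x (q , _) → h⇒M p x q) (λ _ (_ , ¬q) (_ , q) → ¬q q))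
      (#M-small Ww)
      (#-cover (h? u v) (λ x → h? u v x ×-dec w ~? x) ∁W? (full⊆full∩part F p Ww))
      #W-small F

    -- Good triples and how the parts of two vertices determine the third

    Good : Fin n → Fin n → Fin n → Set
    Good u v w = h u v w × (W u × W v × W w) × Full u v × Full u w × Full v w

    Good? : ∀ u v w → Dec (Good u v w)
    Good? u v w = h? u v w ×-dec (W? u ×-dec W? v ×-dec W? w) ×-dec Full? u v ×-dec Full? u w ×-dec Full? v w

    Good-swap : ∀ {u v w} → Good u v w → Good v u w
    Good-swap (p , (Wu , Wv , Ww) , uv , uw , vw) = h-swap p , (Wv , Wu , Ww) , Full-sym uv , vw , uw

    Good-swap₂ : ∀ {u v w} → Good u v w → Good u w v
    Good-swap₂ (p , (Wu , Wv , Ww) , uv , uw , vw) = h-swap₂ p , (Wu , Ww , Wv) , uw , uv , Full-sym vw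

    -- If u and v shared a part, then N(uw), which contains v, would lie in the part of u up to
    -- atypical vertices. Its elements are all adjacent to u, but only 9c members of that part are,
    -- too few for a full N(uw).
    Good-distinct : ∀ {u v w} → Good u v w → ¬ u ~ v
    Good-distinct {u} {v} {w} (p , (Wu , Wv , Ww) , uv , uw , vw) u~v = n≮n a
      (no-inner-pair uw (#-cover (h? u w) (λ x → (u ~? x) ×-dec ¬? (M? u x)) ∁W? split) (#part∖M Wu) #W-small)
      where
      split : ∀ x → h u w x → (u ~ x × ¬ M u x) ⊎ ¬ W x
      split x q = Sum.map₁ (λ v~x → ~-trans u~v v~x , λ m → m (h⇒G₂ q)) (full⊆part uw (h-swap₂ p) Wv x q)

    -- A replacement x for v fails only if it is missing from N(uw), which costs 9c, or forms a bad
    -- pair with u or with w, which costs c each.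
    Good-row : ∀ {u v w} → Good u v w → # (λ x → (v ~? x) ×-dec ¬? (Good? u x w)) ≤ 11 * c
    Good-row {u} {v} {w} (p , (Wu , Wv , Ww) , uv , uw , vw) = row-exceptions
      (≤-trans (#-cover (λ x → (v ~? x) ×-dec ¬? (Good? u x w)) (λ x → (v ~? x) ×-dec ¬? (h? u w x))
          (λ x → Bad? u x ⊎-dec Bad? w x) split)
        (+-monoʳ-≤ _ (#-⊎ (Bad? u) (Bad? w))))
      (#part∖full uw (h-swap₂ p) Wv) (#bad-small Wu) (#bad-small Ww)
      where
      split : ∀ x → v ~ x × ¬ Good u x w → (v ~ x × ¬ h u w x) ⊎ (Bad u x ⊎ Bad w x)
      split x (v~x , ¬g) with h? u w x | Bad? u x | Bad? w x
      ... | no ¬q | _      | _      = inj₁ (v~x , ¬q)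
      ... | yes q | yes b  | _      = inj₂ (inj₁ b)
      ... | yes q | no ¬b  | yes b  = inj₂ (inj₂ b)
      ... | yes q | no ¬b  | no ¬b′ = ⊥-elim (¬g (h-swap₂ q , (Wu , proj₁ (proj₂ v~x) , Ww) ,
        full (h⇒G₂ q) ¬b , uw , Full-sym (full (h⇒G (h-rotate q)) ¬b′)))

    -- The two triples exclude at most 22c candidates, and the common part has at least a - 2c
    -- members.
    Good-common : ∀ {u v w u′ v′ w′} → Good u v w → Good u′ v′ w′ → v ~ v′ →
      ∃ λ x → v ~ x × Good u x w × Good u′ x w′
    Good-common {u} {v} {w} {u′} {v′} {w′} g g′ v~v′ =
      let x , v~x , ¬q , ¬q′ = pick₂ (v ~?_)
            (λ x → (v ~? x) ×-dec ¬? (Good? u x w)) (λ x → (v′ ~? x) ×-dec ¬? (Good? u′ x w′))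
            (avoid-rows (Good-row g) (Good-row g′) (part-large (proj₁ v~v′)))
      in x , v~x ,
        decidable-stable (Good? u x w) (λ r → ¬q (v~x , r)) ,
        decidable-stable (Good? u′ x w′) (λ r → ¬q′ (~-trans (~-sym v~v′) v~x , r))

    -- Both triples are moved to the same middle vertex x and then to the same vertex y in place of
    -- u and u′. Now w and w′ lie in the same full N(xy), hence in the same part.
    Good-unique : ∀ {u v w u′ v′ w′} → Good u v w → Good u′ v′ w′ → u ~ u′ → v ~ v′ → w ~ w′
    Good-unique g g′ u~u′ v~v′ =
      let x , _ , g₁ , g₁′ = Good-common g g′ v~v′
          y , _ , (p , (_ , _ , Ww) , F , _) , (p′ , (_ , _ , Ww′) , _) =
            Good-common (Good-swap g₁) (Good-swap g₁′) u~u′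
      in same-pair⇒~ F p p′ Ww Ww′

    -- All but 3c non-neighbours of u lie in the part of u, so almost all of the part of v is
    -- adjacent to u. A suitable x there makes ux full, and N(ux) is too large to consist of
    -- atypical vertices and of bad partners of u or x.
    Good-exists : ∀ {u v} → W u → W v → ¬ u ~ v → ∃₂ λ x w → v ~ x × Good u x w
    Good-exists {u} {v} Wu Wv u≁v =
      let x , v~x@(_ , Wx , _) , ¬m , ¬b = pick₂ (v ~?_) (λ x → M? u x ×-dec ¬? (u ~? x)) (Bad? u)
            (avoid-part (#M∖part Wu) (#bad-small Wu) (part-large Wv))
          ux = full (G-stable λ m → ¬m (m , λ u~x → u≁v (~-trans u~x (~-sym v~x)))) ¬b
          w , p , ¬¬Ww , ¬b₁ , ¬b₂ = pick₃ (h? u x) ∁W? (Bad? u) (Bad? x)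
            (avoid-bad #W-small (#bad-small Wu) (#bad-small Wx) ux)
      in x , w , v~x , p , (Wu , Wx , W-stable ¬¬Ww) ,
        ux , full (h⇒G₂ p) ¬b₁ , full (h⇒G (h-rotate p)) ¬b₂

    -- Exactly `k` parts: a greedy choice of representatives

    record Representatives (m : ℕ) : Set where
      field
        rep      : Fin m → Fin n
        rep∈W    : ∀ i → W (rep i)
        distinct : ∀ i j → rep i ~ rep j → i ≡ j

      parts-lower : m * a ≤ n + m * (2 * c)
      parts-lower = begin
        m * a                                            ≡⟨ ∑-const m a ⟨
        ∑ {m} (λ _ → a)                                  ≤⟨ ∑-≤-+ (λ i → part-large (rep∈W i)) ⟩
        ∑ (λ i → # (rep i ~?_)) + ∑ {m} (λ _ → 2 * c)    ≡⟨ cong₂ _+_ (∑-swap λ i x → 𝟙 (rep i ~? x)) (∑-const m (2 * c)) ⟩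
        ∑ (λ x → # λ i → rep i ~? x) + m * (2 * c)       ≤⟨ +-monoˡ-≤ _ (∑-bound 1 λ x → #-subsingleton (λ i → rep i ~? x)
                                                              λ i j p q → distinct i j (~-trans p (~-sym q))) ⟩
        n * 1 + m * (2 * c)                              ≡⟨ cong (_+ m * (2 * c)) (*-identityʳ n) ⟩
        n + m * (2 * c)                                  ∎
        where open ≤-Reasoning

      parts-upper : (∀ x → W x → ∃ λ i → rep i ~ x) → n ≤ m * (a + 7 * c) + c
      parts-upper covers = begin
        n                                            ≡⟨ trans (∑-const n 1) (*-identityʳ n) ⟨
        ∑ {n} (λ _ → 1)                              ≤⟨ ∑-≤-+ pointwise ⟩
        ∑ (λ x → # λ i → rep i ~? x) + # ∁W?         ≡⟨ cong (_+ # ∁W?) (∑-swap λ x i → 𝟙 (rep i ~? x)) ⟩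
        ∑ (λ i → # (rep i ~?_)) + # ∁W?              ≤⟨ ∑-bound (a + 7 * c) (λ i → part-small (rep∈W i)) ⊞ #W-small ⟩
        m * (a + 7 * c) + c                          ∎
        where
        open ≤-Reasoning
        pointwise : ∀ x → 1 ≤ # (λ i → rep i ~? x) + 𝟙 (∁W? x)
        pointwise x = 𝟙-¬-+ (W? x) λ Wx → #-inhabited (λ i → rep i ~? x) _ (proj₂ (covers x Wx))

    open Representatives

    Uncovered : ∀ {m} → Representatives m → Set
    Uncovered R = ∃ λ x → W x × ¬ ∃ λ i → rep R i ~ x

    uncovered? : ∀ {m} (R : Representatives m) → Dec (Uncovered R)
    uncovered? R = Fin.any? λ x → W? x ×-dec ¬? (Fin.any? λ i → rep R i ~? x)

    covered : ∀ {m} (R : Representatives m) → ¬ Uncovered R → ∀ x → W x → ∃ λ i → rep R i ~ x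
    covered R ¬u x Wx = decidable-stable (Fin.any? λ i → rep R i ~? x) λ ¬c → ¬u (x , Wx , ¬c)

    extend : ∀ {m} (R : Representatives m) → Uncovered R → Representatives (suc m)
    extend {m} R (x , Wx , ¬c) = record { rep = rep′ ; rep∈W = rep′∈W ; distinct = distinct′ }
      where
      rep′ : Fin (suc m) → Fin n
      rep′ zero    = x
      rep′ (suc i) = rep R i
      rep′∈W : ∀ i → W (rep′ i)
      rep′∈W zero    = Wx
      rep′∈W (suc i) = rep∈W R i
      distinct′ : ∀ i j → rep′ i ~ rep′ j → i ≡ j
      distinct′ zero    zero    _ = refl
      distinct′ zero    (suc j) p = ⊥-elim (¬c (j , ~-sym p))
      distinct′ (suc i) zero    p = ⊥-elim (¬c (i , p))
      distinct′ (suc i) (suc j) p = cong suc (distinct R i j p)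

    -- Fewer than `k` parts, each of size at most a + 7c, and `c` atypical vertices leave some of
    -- the n ≥ ka vertices uncovered.
    add-representative : ∀ {m} → Representatives m → m < k → Representatives (suc m)
    add-representative {m} R m<k with uncovered? R
    ... | yes u = extend R u
    ... | no ¬u = ⊥-elim (n≮n a (too-few-parts {m = m} (parts-upper R (covered R ¬u)) ka≤n m<k 30kc≤a))

    representatives : ∀ m → m ≤ k → Representatives m
    representatives zero    _   = record { rep = λ () ; rep∈W = λ () ; distinct = λ () }
    representatives (suc m) m<k = add-representative (representatives m (<⇒≤ m<k)) m<k

    parts : Representatives k
    parts = representatives k ≤-refl

    -- An uncovered typical vertex would open one more part, and k + 1 disjoint parts of size at
    -- least a - 2c do not fit into n ≤ ka + c vertices.
    parts-cover : ∀ x → W x → ∃ λ i → rep parts i ~ x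
    parts-cover = covered parts λ u → n≮n a (too-many-parts {k} (parts-lower (extend parts u)) n≤ka+c 30kc≤a 2≤k)

    φ : Fin n → Fin k
    φ x with W? x
    ... | yes Wx = proj₁ (parts-cover x Wx)
    -- Atypical vertices get the first class; the edges kept in the end have only typical vertices.
    ... | no _   = fromℕ< {0} (≤-trans (s≤s z≤n) 2≤k)

    φ-rep : ∀ {x} → W x → rep parts (φ x) ~ x
    φ-rep {x} Wx with W? x
    ... | yes Wx′ = proj₂ (parts-cover x Wx′)
    ... | no ¬Wx  = ⊥-elim (¬Wx Wx)

    φ≡⇒~ : ∀ {x y} → W x → W y → φ x ≡ φ y → x ~ y
    φ≡⇒~ {x} {y} Wx Wy eq = ~-trans (~-sym (φ-rep Wx)) (subst (λ i → rep parts i ~ y) (sym eq) (φ-rep Wy))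

    ~⇒φ≡ : ∀ {x y} → x ~ y → φ x ≡ φ y
    ~⇒φ≡ p@(Wx , Wy , _) = distinct parts _ _ (~-trans (φ-rep Wx) (~-trans p (~-sym (φ-rep Wy))))

    φ-distinct : ∀ {u v w} → Good u v w → φ u ≢ φ v
    φ-distinct g@(_ , (Wu , Wv , _) , _) eq = Good-distinct g (φ≡⇒~ Wu Wv eq)

    φ-unique : ∀ {u v w u′ v′ w′} → Good u v w → Good u′ v′ w′ → φ u ≡ φ u′ → φ v ≡ φ v′ → φ w ≡ φ w′
    φ-unique g@(_ , (Wu , Wv , _) , _) g′@(_ , (Wu′ , Wv′ , _) , _) p q =
      ~⇒φ≡ (Good-unique g g′ (φ≡⇒~ Wu Wu′ p) (φ≡⇒~ Wv Wv′ q))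

    φ-exists : ∀ {i j} → i ≢ j → ∃ λ u → ∃ λ v → ∃ λ w → Good u v w × φ u ≡ i × φ v ≡ j
    φ-exists {i} {j} i≢j =
      let v , w , j~v , g = Good-exists (rep∈W parts i) (rep∈W parts j) λ p → i≢j (distinct parts i j p)
      in rep parts i , v , w , g , φrep i , trans (sym (~⇒φ≡ j~v)) (φrep j)
      where
      φrep : ∀ i → φ (rep parts i) ≡ i
      φrep i = distinct parts _ _ (φ-rep (rep∈W parts i))

    -- An edge triple fails to be good for one of six reasons: one of its three vertices is
    -- atypical, or one of its three pairs is bad. In each case two free coordinates leave at most
    -- `c` choices for the remaining one.
    few-lost : ∑³ (λ x y z → 𝟙 (h? x y z ×-dec ¬? (Good? x y z))) ≤ 6 * (n * (n * c))
    few-lost = begin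
      ∑³ (λ x y z → 𝟙 (h? x y z ×-dec ¬? (Good? x y z)))       ≤⟨ ∑³-mono pointwise ⟩
      ∑³ (λ x y z → f₁ x y z + (f₂ x y z + (f₃ x y z + (f₄ x y z + (f₅ x y z + f₆ x y z)))))
        ≡⟨ trans (∑³-+ f₁ _) (cong (∑³ f₁ +_) (trans (∑³-+ f₂ _) (cong (∑³ f₂ +_) (trans (∑³-+ f₃ _) (cong (∑³ f₃ +_)
             (trans (∑³-+ f₄ _) (cong (∑³ f₄ +_) (∑³-+ f₅ f₆)))))))) ⟩
      ∑³ f₁ + (∑³ f₂ + (∑³ f₃ + (∑³ f₄ + (∑³ f₅ + ∑³ f₆))))
        ≤⟨ by-rotation ⊞ (by-swap f₂ (λ x z → #W-small) ⊞ (by-column f₃ (λ x y → #W-small) ⊞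
             (by-swap f₄ (λ x z → E-small x) ⊞ (by-column f₅ (λ x y → E-small x) ⊞ by-column f₆ (λ x y → E-small y))))) ⟩
      s + (s + (s + (s + (s + s))))                             ≡⟨ lemma s ⟩
      6 * s                                                     ∎
      where
      open ≤-Reasoning
      s = n * (n * c)
      lemma : ∀ s → s + (s + (s + (s + (s + s)))) ≡ 6 * s
      lemma = solve-∀
      -- The first vertex is required to be typical because only then is the number of its bad
      -- partners bounded; the other case is already counted among the atypical vertices.
      E? : ∀ x y → Dec (W x × Bad x y)
      E? x y = W? x ×-dec Bad? x y
      f₁ f₂ f₃ f₄ f₅ f₆ : Fin n → Fin n → Fin n → ℕ
      f₁ x y z = 𝟙 (∁W? x)
      f₂ x y z = 𝟙 (∁W? y)
      f₃ x y z = 𝟙 (∁W? z)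
      f₄ x y z = 𝟙 (E? x y)
      f₅ x y z = 𝟙 (E? x z)
      f₆ x y z = 𝟙 (E? y z)
      E-small : ∀ x → # (E? x) ≤ c
      E-small x = [ (λ Wx → ≤-trans (#-mono (E? x) (Bad? x) λ _ → proj₂) (#bad-small Wx))
                  , (λ ¬Wx → ≤-trans (≤-reflexive (#-none (E? x) λ _ → ¬Wx ∘ proj₁)) z≤n) ]′ (toSum (W? x))
      by-column : ∀ f → (∀ x y → ∑ (f x y) ≤ c) → ∑³ f ≤ s
      by-column f p = ∑-bound _ λ x → ∑-bound c λ y → p x y
      by-swap : ∀ f → (∀ x z → ∑ (λ y → f x y z) ≤ c) → ∑³ f ≤ s
      by-swap f p = ∑-bound _ λ x → ≤-trans (≤-reflexive (∑-swap (f x))) (∑-bound c λ z → p x z)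
      by-rotation : ∑³ f₁ ≤ s
      by-rotation = ≤-trans (≤-reflexive (∑³-rotate f₁)) (by-column (λ y z x → f₁ x y z) λ _ _ → #W-small)
      pointwise : ∀ x y z → 𝟙 (h? x y z ×-dec ¬? (Good? x y z)) ≤
        f₁ x y z + (f₂ x y z + (f₃ x y z + (f₄ x y z + (f₅ x y z + f₆ x y z))))
      pointwise x y z = ≤-trans (𝟙-cover lost? (∁W? x) d₂ cover) (+-monoʳ-≤ _ (≤-trans (𝟙-⊎ (∁W? y) d₃)
          (+-monoʳ-≤ _ (≤-trans (𝟙-⊎ (∁W? z) d₄) (+-monoʳ-≤ _ (≤-trans (𝟙-⊎ (E? x y) d₅)
          (+-monoʳ-≤ _ (𝟙-⊎ (E? x z) (E? y z)))))))))
        where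
        lost? = h? x y z ×-dec ¬? (Good? x y z)
        d₅ = E? x z ⊎-dec E? y z
        d₄ = E? x y ⊎-dec d₅
        d₃ = ∁W? z ⊎-dec d₄
        d₂ = ∁W? y ⊎-dec d₃
        cover : h x y z × ¬ Good x y z → ¬ W x ⊎ (¬ W y ⊎ (¬ W z ⊎ ((W x × Bad x y) ⊎ ((W x × Bad x z) ⊎ (W y × Bad y z)))))
        cover (p , ¬g) with W? x | W? y | W? z | Bad? x y | Bad? x z | Bad? y z
        ... | no ¬Wx | _ | _ | _ | _ | _ = inj₁ ¬Wx
        ... | yes _ | no ¬Wy | _ | _ | _ | _ = inj₂ (inj₁ ¬Wy)
        ... | yes _ | yes _ | no ¬Wz | _ | _ | _ = inj₂ (inj₂ (inj₁ ¬Wz))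
        ... | yes Wx | yes _ | yes _ | yes b | _ | _ = inj₂ (inj₂ (inj₂ (inj₁ (Wx , b))))
        ... | yes Wx | yes _ | yes _ | no _ | yes b | _ = inj₂ (inj₂ (inj₂ (inj₂ (inj₁ (Wx , b)))))
        ... | yes _ | yes Wy | yes _ | no _ | no _ | yes b = inj₂ (inj₂ (inj₂ (inj₂ (inj₂ (Wy , b)))))
        ... | yes Wx | yes Wy | yes Wz | no ¬b₁ | no ¬b₂ | no ¬b₃ = ⊥-elim (¬g (p , (Wx , Wy , Wz) ,
          full (h⇒G p) ¬b₁ , full (h⇒G₂ p) ¬b₂ , full (h⇒G (h-rotate p)) ¬b₃))

  -- Near-extremality of almost all vertices and pairs

  -- The variance estimate, multiplied by 1 + η = 1/ε to stay in the natural numbers, with k = 2 +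
  -- j. In its use `e` counts ordered edges, `t` ordered shadow pairs, and `F` and `Q` are the sums
  -- of f and f².
  energy-bound : ∀ {e Q n F η j t} → e + Q ≤ n * F →
    η * (1 + j) * (n * n * n) ≤ (1 + η) * ((2 + j) * (2 + j) * e) →
    η * (1 + j) * (n * n) ≤ (1 + η) * ((2 + j) * t) → F + t ≤ n * n →
    (1 + η) * ((2 + j) * (2 + j) * Q + n * n * n) ≤ (1 + η) * (2 * ((2 + j) * n * F)) + (1 + j) * (1 + j) * (n * n * n)
  energy-bound {e} {Q} {n} {F} {η} {j} {t} h₁ h₂ h₃ h₄ = by-cert 0
    (((1 + η) * ((2 + j) * (2 + j))) ⊠ h₁ ⊞ h₂ ⊞ (j * n) ⊠ h₃ ⊞ ((1 + η) * (2 + j) * (j * n)) ⊠ h₄)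
    (solve (e ∷ Q ∷ n ∷ F ∷ η ∷ j ∷ t ∷ []))

  adjacency-bound : ∀ {n j F b t} → n * n ≤ (2 + j) * F + (n * b + n * b) → F + t ≤ n * n →
    (2 + j) * t ≤ (1 + j) * (n * n) + 2 * (b * n)
  adjacency-bound {n} {j} {F} {b} {t} h₁ h₂ = by-cert 0
    (h₁ ⊞ (2 + j) ⊠ h₂)
    (solve (n ∷ j ∷ F ∷ b ∷ t ∷ []))

  edges-lower : ∀ {η j n e b} → η * (1 + j) * (n * n * n) ≤ (1 + η) * ((2 + j) * (2 + j) * e) →
    (1 + j) * n ≤ (1 + η) * (1 + b) →
    (1 + η) * ((1 + j) * (n * n * n)) ≤ (1 + η) * ((2 + j) * (2 + j) * e + (1 + b) * (n * n))
  edges-lower {η} {j} {n} {e} {b} h₁ h₂ = by-cert 0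
    (h₁ ⊞ (n * n) ⊠ h₂)
    (solve (η ∷ j ∷ n ∷ e ∷ b ∷ []))

  -- Multiplied by k², the right side (a + b)t is at most (n + kb)(κn² + 2bn) with κ = 1 + j, and
  -- its main term κn³ cancels against that of k²e. The rest is at most (6 + kκ)bn², and 6 + kκ is
  -- at most 7k².
  deficiency-bound : ∀ {c B e a b t j n} → c * B + e ≤ (a + b) * t →
    (2 + j) * t ≤ (1 + j) * (n * n) + 2 * (b * n) → (2 + j) * a ≤ n →
    (1 + j) * (n * n * n) ≤ (2 + j) * (2 + j) * e + (1 + b) * (n * n) → (2 + j) * b ≤ n → 1 ≤ b →
    ((2 + j) * (2 + j)) * (c * B) ≤ ((2 + j) * (2 + j)) * (7 * (b * (n * n)))
  deficiency-bound {c} {B} {e} {a} {b} {t} {j} {n} h₁ h₂ h₃ h₄ h₅ h₆ = by-cert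
    (6 * b * j * j * n * n + 25 * b * j * n * n + 20 * b * n * n)
    (((2 + j) * (2 + j)) ⊠ h₁ ⊞ ((n + (2 + j) * b)) ⊠ h₂ ⊞ (((2 + j) * t)) ⊠ h₃ ⊞ h₄ ⊞ (2 * b * n) ⊠ h₅ ⊞ (n * n) ⊠ h₆)
    (solve (c ∷ B ∷ e ∷ a ∷ b ∷ t ∷ j ∷ n ∷ []))

  -- c²q ≤ cB ≤ 7bn² ≤ 28Y²bc², the last because n is at most 2Yc. This is where the ratio between
  -- `c` and `b` comes from.
  many-bad-bound : ∀ {q c B b n Y} → q * (1 + c) ≤ B → c * B ≤ 7 * (b * (n * n)) →
    n * n ≤ (2 * (Y * c)) * (2 * (Y * c)) → (c * c) * q ≤ (c * c) * (28 * (Y * Y) * b)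
  many-bad-bound {q} {c} {B} {b} {n} {Y} h₁ h₂ h₃ = by-cert (c * q)
    (c ⊠ h₁ ⊞ h₂ ⊞ (7 * b) ⊠ h₃)
    (solve (q ∷ c ∷ B ∷ b ∷ n ∷ Y ∷ []))

  #-complement : ∀ {n} {P : Fin n → Set} (P? : ∀ i → Dec (P i)) → # P? + # (λ i → ¬? (P? i)) ≡ n
  #-complement {n} P? = trans (sym (∑-+ _ _)) (trans (∑-cong λ i → pointwise (P? i)) (trans (∑-const n 1) (*-identityʳ n)))
    where
    pointwise : {P : Set} (p : Dec P) → 𝟙 p + 𝟙 (¬? p) ≡ 1
    pointwise (yes _) = refl
    pointwise (no _)  = refl

  -- This is min(N, x) as a sum over levels. With N = n it is exact for degrees, and for other
  -- values it can only be too small, which is the harmless direction on the larger side.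
  layers : ℕ → ℕ → ℕ
  layers N x = # {N} (λ t → suc (toℕ t) ≤? x)

  layers-zero : ∀ N → layers N 0 ≡ 0
  layers-zero N = #-none {N} (λ t → suc (toℕ t) ≤? 0) λ _ ()

  layers-≤ : ∀ N x → layers N x ≤ x
  layers-≤ N       zero    = ≤-reflexive (layers-zero N)
  layers-≤ zero    (suc x) = ≤-trans (≤-reflexive (∑-zero _)) z≤n
  layers-≤ (suc N) (suc x) = ≤-trans (≤-reflexive (∑-suc _)) (s≤s (layers-≤ N x))

  layers-≥ : ∀ N x → x ≤ N → x ≤ layers N x
  layers-≥ N       zero    _         = z≤n
  layers-≥ (suc N) (suc x) (s≤s x≤N) = ≤-trans (s≤s (layers-≥ N x x≤N)) (≤-reflexive (sym (∑-suc _)))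

  -- If a/b + b/a ≥ 2 is summed over the edges vw with a = deg v and b = deg w, one gets
  -- ∑ deg ≤ ∑ f; comparing the level sets of deg and f instead avoids the fractions.
  module DegreeSum {n : ℕ} (L : Fin n → Fin n → Set) (L? : ∀ v w → Dec (L v w))
    (L-sym : ∀ {v w} → L v w → L w v) (f : Fin n → ℕ)
    (deg≤f : ∀ {v w} → L v w → # (L? v) ≤ f w) where

    module Level (t : ℕ) where
      A? : ∀ v → Dec (t < # (L? v))
      A? v = suc t ≤? # (L? v)
      B? : ∀ v → Dec (t < f v)
      B? v = suc t ≤? f v
      A∖B? : ∀ v → Dec (t < # (L? v) × ¬ t < f v)
      A∖B? v = A? v ×-dec ¬? (B? v)
      B∖A? : ∀ v → Dec (t < f v × ¬ t < # (L? v))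
      B∖A? v = B? v ×-dec ¬? (A? v)
      A∩B? : ∀ v → Dec (t < # (L? v) × t < f v)
      A∩B? v = A? v ×-dec B? v
      edge? : ∀ v w → Dec ((t < # (L? v) × ¬ t < f v) × L v w)
      edge? v w = A∖B? v ×-dec L? v w

      out : ∀ v → 𝟙 (A∖B? v) * suc t ≤ # (edge? v)
      out v = 𝟙-*-≤ (A∖B? v) λ p → ≤-trans (proj₁ p) (#-mono (L? v) (edge? v) λ _ l → p , l)

      into : ∀ w → # (λ v → edge? v w) ≤ 𝟙 (B∖A? w) * suc t
      into w = ≤-𝟙-* (B∖A? w)
        (λ ¬q → ≤-reflexive (#-none (λ v → edge? v w) λ v ((p , ¬r) , l) →
          ¬q (≤-trans p (deg≤f l) , λ s → ¬r (≤-trans s (deg≤f (L-sym l))))))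
        λ (_ , ¬s) → ≤-trans (#-mono (λ v → edge? v w) (L? w) λ _ (_ , l) → L-sym l) (≤-trans (≮⇒≥ ¬s) (n≤1+n t))

      -- If deg v > t but f(v) ≤ t, then every neighbour w has f(w) ≥ deg v > t and deg w ≤ f(v) ≤
      -- t. So all edges at `A∖B?` end in `B∖A?`; each vertex of the former sends at least t + 1 of
      -- them, and each vertex of the latter receives at most t.
      differences : # A∖B? ≤ # B∖A?
      differences = *-cancelʳ-≤ (# A∖B?) (# B∖A?) (suc t) (begin
        # A∖B? * suc t                    ≡⟨ ∑-*ʳ (suc t) _ ⟩
        ∑ (λ v → 𝟙 (A∖B? v) * suc t)      ≤⟨ ∑-mono out ⟩
        ∑ (λ v → ∑ λ w → 𝟙 (edge? v w))   ≡⟨ ∑-swap (λ v w → 𝟙 (edge? v w)) ⟩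
        ∑ (λ w → ∑ λ v → 𝟙 (edge? v w))   ≤⟨ ∑-mono into ⟩
        ∑ (λ w → 𝟙 (B∖A? w) * suc t)      ≡⟨ ∑-*ʳ (suc t) _ ⟨
        # B∖A? * suc t                    ∎)
        where open ≤-Reasoning

      level : # A? ≤ # B?
      level = begin
        # A?                ≤⟨ #-cover A? A∖B? A∩B? (λ v p → Sum.map (p ,_) (p ,_) (Sum.swap (toSum (B? v)))) ⟩
        # A∖B? + # A∩B?     ≤⟨ +-monoˡ-≤ _ differences ⟩
        # B∖A? + # A∩B?     ≤⟨ #-disjoint B∖A? A∩B? B? (λ _ → proj₁) (λ _ → proj₂) (λ _ (_ , ¬q) (q , _) → ¬q q) ⟩
        # B?                ∎
        where open ≤-Reasoning

    degree-sum : ∑ (λ v → # (L? v)) ≤ ∑ f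
    degree-sum = begin
      ∑ (λ v → # (L? v))              ≤⟨ ∑-mono (λ v → layers-≥ n _ (#≤n (L? v))) ⟩
      ∑ (λ v → layers n (# (L? v)))   ≡⟨ ∑-swap (λ v (t : Fin n) → 𝟙 (suc (toℕ t) ≤? # (L? v))) ⟩
      ∑ {n} (λ t → # (Level.A? (toℕ t)))  ≤⟨ ∑-mono (λ t → Level.level (toℕ t)) ⟩
      ∑ {n} (λ t → # (Level.B? (toℕ t)))  ≡⟨ ∑-swap (λ (t : Fin n) v → 𝟙 (suc (toℕ t) ≤? f v)) ⟩
      ∑ (λ v → layers n (f v))        ≤⟨ ∑-mono (λ v → layers-≤ n (f v)) ⟩
      ∑ f                             ∎
      where open ≤-Reasoning

  distance-square : ∀ x y → x * x + y * y ≡ 2 * (x * y) + ∣ x - y ∣ * ∣ x - y ∣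
  distance-square x y with ≤-total x y
  ... | inj₁ x≤y rewrite m≤n⇒∣m-n∣≡n∸m x≤y = begin
    x * x + y * y                                           ≡⟨ cong (λ z → x * x + z * z) (m+[n∸m]≡n x≤y) ⟨
    x * x + (x + d) * (x + d)                               ≡⟨ lemma x d ⟩
    2 * (x * (x + d)) + d * d                               ≡⟨ cong (λ z → 2 * (x * z) + d * d) (m+[n∸m]≡n x≤y) ⟩
    2 * (x * y) + d * d                                     ∎
    where
    open ≡-Reasoning
    d = y ∸ x
    lemma : ∀ x d → x * x + (x + d) * (x + d) ≡ 2 * (x * (x + d)) + d * d
    lemma = solve-∀
  ... | inj₂ y≤x rewrite m≤n⇒∣n-m∣≡n∸m y≤x = begin
    x * x + y * y                                           ≡⟨ cong (λ z → z * z + y * y) (m+[n∸m]≡n y≤x) ⟨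
    (y + d) * (y + d) + y * y                               ≡⟨ lemma y d ⟩
    2 * ((y + d) * y) + d * d                               ≡⟨ cong (λ z → 2 * (z * y) + d * d) (m+[n∸m]≡n y≤x) ⟩
    2 * (x * y) + d * d                                     ∎
    where
    open ≡-Reasoning
    d = x ∸ y
    lemma : ∀ y d → (y + d) * (y + d) + y * y ≡ 2 * ((y + d) * y) + d * d
    lemma = solve-∀

  module Stability {n : ℕ}
    (h : Fin n → Fin n → Fin n → Set) (h? : ∀ x y z → Dec (h x y z))
    (G : Fin n → Fin n → Set) (G? : ∀ x y → Dec (G x y))
    (h-rotate : ∀ {x y z} → h x y z → h y z x)
    (h-swap : ∀ {x y z} → h x y z → h y x z)
    (h⇒G : ∀ {x y z} → h x y z → G x y)
    (G-sym : ∀ {x y} → G x y → G y x)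
    (independent : ∀ {u v w w′} → h u v w → h u v w′ → ¬ G w w′)
    (j Y N b c a η : ℕ)
    (1≤N : 1 ≤ N) (κ²N³≤η : (1 + j) * (1 + j) * (N * N * N) ≤ η) (n<N[1+b] : n < N * (1 + b))
    (1≤b : 1 ≤ b) (28Y²b+b≤c : 28 * (Y * Y) * b + b ≤ c)
    (kb≤n : (2 + j) * b ≤ n) (n≤2Yc : n ≤ 2 * (Y * c))
    (ka≤n : (2 + j) * a ≤ n) (n<k[1+a] : n < (2 + j) * (1 + a))
    (shadow-large : η * (1 + j) * (n * n) ≤ (1 + η) * ((2 + j) * ∑ (λ x → # (G? x))))
    (edges-large : η * (1 + j) * (n * n * n) ≤ (1 + η) * ((2 + j) * (2 + j) * ∑³ (λ x y z → 𝟙 (h? x y z))))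
    where

    k κ : ℕ
    k = 2 + j
    κ = 1 + j

    M? : ∀ x y → Dec (¬ G x y)
    M? x y = ¬? (G? x y)

    f : Fin n → ℕ
    f x = # (M? x)

    d : Fin n → Fin n → ℕ
    d u v = # (h? u v)

    e t F Q : ℕ
    e = ∑³ (λ x y z → 𝟙 (h? x y z))
    t = ∑ (λ x → # (G? x))
    F = ∑ f
    Q = ∑ (λ x → f x * f x)

    d≤f : ∀ {u v w} → h u v w → d u v ≤ f w
    d≤f {u} {v} {w} p = #-mono (h? u v) (M? w) λ _ q → independent p q

    h-swap₂ : ∀ {x y z} → h x y z → h x z y
    h-swap₂ = h-swap ∘ h-rotate ∘ h-rotate

    h⇒G₂ : ∀ {x y z} → h x y z → G x z
    h⇒G₂ = h⇒G ∘ h-swap₂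

    -- The weight f(v) is kept only on neighbours of u. All vertices of an edge of the link are such
    -- neighbours, so the degree condition survives; summed over u, each f(v) is then counted n -
    -- f(v) times instead of n times.
    link-sum : ∀ u → ∑ (λ v → d u v) ≤ ∑ (λ v → 𝟙 (G? u v) * f v)
    link-sum u = DegreeSum.degree-sum (h u) (h? u) h-swap₂ (λ v → 𝟙 (G? u v) * f v)
      λ {v} {w} p → ≤-trans (d≤f p)
        (≤-reflexive (sym (trans (cong (_* f w) (𝟙-yes (G? u w) (h⇒G₂ p))) (*-identityˡ (f w)))))

    adjacent+non-adjacent : ∀ v → # (G? v) + f v ≡ n
    adjacent+non-adjacent v = #-complement (G? v)

    edge-bound : e + Q ≤ n * F
    edge-bound = begin
      e + Q                                             ≤⟨ +-monoˡ-≤ Q (∑-mono link-sum) ⟩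
      ∑ (λ u → ∑ λ v → 𝟙 (G? u v) * f v) + Q            ≡⟨ cong (_+ Q) (∑-swap λ u v → 𝟙 (G? u v) * f v) ⟩
      ∑ (λ v → ∑ λ u → 𝟙 (G? u v) * f v) + Q            ≡⟨ ∑-+ _ _ ⟨
      ∑ (λ v → ∑ (λ u → 𝟙 (G? u v) * f v) + f v * f v)  ≤⟨ ∑-mono pointwise ⟩
      ∑ (λ v → n * f v)                                 ≡⟨ ∑-*ˡ n f ⟨
      n * F                                             ∎
      where
      open ≤-Reasoning
      pointwise : ∀ v → ∑ (λ u → 𝟙 (G? u v) * f v) + f v * f v ≤ n * f v
      pointwise v = begin
        ∑ (λ u → 𝟙 (G? u v) * f v) + f v * f v   ≡⟨ cong (_+ f v * f v) (∑-*ʳ (f v) _) ⟨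
        # (λ u → G? u v) * f v + f v * f v        ≤⟨ +-monoˡ-≤ _ (*-monoˡ-≤ (f v) (#-mono (λ u → G? u v) (G? v) λ _ → G-sym)) ⟩
        # (G? v) * f v + f v * f v                ≡⟨ *-distribʳ-+ (f v) (# (G? v)) (f v) ⟨
        (# (G? v) + f v) * f v                    ≡⟨ cong (_* f v) (adjacent+non-adjacent v) ⟩
        n * f v                                   ∎

    F+t≤n² : F + t ≤ n * n
    F+t≤n² = ≤-reflexive (trans (sym (∑-+ _ _))
      (trans (∑-cong λ v → trans (+-comm (f v) _) (adjacent+non-adjacent v)) (∑-const n n)))

    deviation : Fin n → ℕ
    deviation v = ∣ k * f v - n ∣

    ∑deviation² : (1 + η) * ∑ (λ v → deviation v * deviation v) ≤ κ * κ * (n * n * n)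
    ∑deviation² = +-cancelˡ-≤ ((1 + η) * (2 * (k * n * F))) _ _ (begin
      (1 + η) * (2 * (k * n * F)) + (1 + η) * D          ≡⟨ *-distribˡ-+ (1 + η) (2 * (k * n * F)) D ⟨
      (1 + η) * (2 * (k * n * F) + D)                    ≡⟨ cong ((1 + η) *_) squares ⟨
      (1 + η) * (k * k * Q + n * n * n)                  ≤⟨ energy-bound {e} {Q} {n} {F} {η} {j} {t}
                                                              edge-bound edges-large shadow-large F+t≤n² ⟩
      (1 + η) * (2 * (k * n * F)) + κ * κ * (n * n * n)  ∎)
      where
      open ≤-Reasoning
      D = ∑ (λ v → deviation v * deviation v)
      expand₁ : ∀ k f n → k * f * (k * f) + n * n ≡ k * k * (f * f) + n * n
      expand₁ = solve-∀
      expand₂ : ∀ k f n → 2 * (k * f * n) ≡ 2 * (k * n) * f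
      expand₂ = solve-∀
      pointwise : ∀ v → k * k * (f v * f v) + n * n ≡ 2 * (k * n) * f v + deviation v * deviation v
      pointwise v = trans (sym (expand₁ k (f v) n))
        (trans (distance-square (k * f v) n) (cong (_+ deviation v * deviation v) (expand₂ k (f v) n)))
      squares : k * k * Q + n * n * n ≡ 2 * (k * n * F) + D
      squares = begin-equality
        k * k * Q + n * n * n                                  ≡⟨ cong₂ _+_ (∑-*ˡ (k * k) _)
                                                                  (trans (*-assoc n n n) (sym (∑-const n (n * n)))) ⟩
        ∑ (λ v → k * k * (f v * f v)) + ∑ {n} (λ _ → n * n)    ≡⟨ ∑-+ _ _ ⟨
        ∑ (λ v → k * k * (f v * f v) + n * n)                  ≡⟨ ∑-cong pointwise ⟩
        ∑ (λ v → 2 * (k * n) * f v + deviation v * deviation v) ≡⟨ ∑-+ _ _ ⟩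
        ∑ (λ v → 2 * (k * n) * f v) + D                        ≡⟨ cong (_+ D) (∑-*ˡ (2 * (k * n)) f) ⟨
        2 * (k * n) * F + D                                    ≡⟨ cong (_+ D) (*-assoc 2 (k * n) F) ⟩
        2 * (k * n * F) + D                                    ∎

    Typical : Fin n → Set
    Typical v = deviation v ≤ b

    Typical? : ∀ v → Dec (Typical v)
    Typical? v = deviation v ≤? b

    -- More than `b` atypical vertices would contribute at least (1 + b)³ to the sum of squared
    -- deviations. Since η ≥ κ²N³, that sum is at most n³/N³, which is below (1 + b)³.
    few-atypical : # (λ v → ¬? (Typical? v)) ≤ b
    few-atypical = ≮⇒≥ λ b<β → n≮n (n * n * n) (begin-strict
      n * n * n                                             <⟨ *-mono-< (*-mono-< n<N[1+b] n<N[1+b]) n<N[1+b] ⟩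
      N * (1 + b) * (N * (1 + b)) * (N * (1 + b))           ≡⟨ rearrange N (1 + b) ⟩
      N * N * N * ((1 + b) * ((1 + b) * (1 + b)))           ≤⟨ *-monoʳ-≤ (N * N * N) (*-monoˡ-≤ ((1 + b) * (1 + b)) b<β) ⟩
      N * N * N * (β * ((1 + b) * (1 + b)))                 ≤⟨ *-monoʳ-≤ (N * N * N) markov² ⟩
      N * N * N * D                                         ≤⟨ *-cancelˡ-≤ (κ * κ) scaled ⟩
      n * n * n                                             ∎)
      where
      open ≤-Reasoning
      β = # (λ v → ¬? (Typical? v))
      D = ∑ (λ v → deviation v * deviation v)
      rearrange : ∀ N x → N * x * (N * x) * (N * x) ≡ N * N * N * (x * (x * x))
      rearrange = solve-∀
      markov² : β * ((1 + b) * (1 + b)) ≤ D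
      markov² = ≤-trans (≤-reflexive (∑-*ʳ ((1 + b) * (1 + b)) _)) (∑-mono λ v →
        𝟙-*-≤ (¬? (Typical? v)) λ ¬p → *-mono-≤ (≰⇒> ¬p) (≰⇒> ¬p))
      scaled : κ * κ * (N * N * N * D) ≤ κ * κ * (n * n * n)
      scaled = begin
        κ * κ * (N * N * N * D)   ≡⟨ *-assoc (κ * κ) (N * N * N) D ⟨
        κ * κ * (N * N * N) * D   ≤⟨ *-monoˡ-≤ D (≤-trans κ²N³≤η (n≤1+n η)) ⟩
        (1 + η) * D               ≤⟨ ∑deviation² ⟩
        κ * κ * (n * n * n)       ∎

    f-upper : ∀ {v} → Typical v → f v ≤ a + b
    f-upper {v} p = ≤-pred (*-cancelˡ-< k (f v) (1 + (a + b)) (begin-strict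
      k * f v                ≤⟨ m≤n+∣m-n∣ (k * f v) n ⟩
      n + deviation v        <⟨ +-mono-<-≤ n<k[1+a] p ⟩
      k * (1 + a) + b        ≤⟨ +-monoʳ-≤ (k * (1 + a)) (m≤n*m b k) ⟩
      k * (1 + a) + k * b    ≡⟨ *-distribˡ-+ k (1 + a) b ⟨
      k * (1 + (a + b))      ∎))
      where open ≤-Reasoning

    -- N(uv) either has at most `b` elements or contains a typical w, and then f(w) bounds its size.
    d-upper : ∀ u v → d u v ≤ a + b
    d-upper u v with d u v ≤? b
    ... | yes p = ≤-trans p (m≤n+m b a)
    ... | no ¬p = let w , q , ¬¬Tw = pick (h? u v) (λ w → ¬? (Typical? w)) (≤-trans (s≤s few-atypical) (≰⇒> ¬p))
      in ≤-trans (d≤f q) (f-upper (decidable-stable (Typical? w) ¬¬Tw))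

    -- A typical v has k f(v) ≥ n - b, and the at most `b` atypical ones are charged n each. So kF ≥
    -- n² - 2bn, and `t` counts the complementary pairs.
    t-upper : k * t ≤ κ * (n * n) + 2 * (b * n)
    t-upper = adjacency-bound {n} {j} {F} {b} {t} (begin
      n * n                                                     ≡⟨ ∑-const n n ⟨
      ∑ {n} (λ _ → n)                                           ≤⟨ ∑-≤-+ (λ v → pointwise v (toSum (Typical? v))) ⟩
      ∑ (λ v → k * f v) + ∑ (λ v → b + 𝟙 (¬? (Typical? v)) * n) ≡⟨ cong₂ _+_ (sym (∑-*ˡ k f)) (trans (∑-+ _ _)
                                                                     (cong₂ _+_ (∑-const n b) (sym (∑-*ʳ n _)))) ⟩
      k * F + (n * b + # (λ v → ¬? (Typical? v)) * n)           ≤⟨ +-monoʳ-≤ (k * F) (+-monoʳ-≤ (n * b)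
                                                                     (*-monoˡ-≤ n few-atypical)) ⟩
      k * F + (n * b + b * n)                                   ≡⟨ cong (λ z → k * F + (n * b + z)) (*-comm b n) ⟩
      k * F + (n * b + n * b)                                   ∎) F+t≤n²
      where
      open ≤-Reasoning
      pointwise : ∀ v → Typical v ⊎ ¬ Typical v → n ≤ k * f v + (b + 𝟙 (¬? (Typical? v)) * n)
      pointwise v (inj₁ p) = ≤-trans (m≤n+∣n-m∣ n (k * f v))
        (+-monoʳ-≤ (k * f v) (≤-trans p (m≤m+n b _)))
      pointwise v (inj₂ ¬p) = ≤-trans (≤-reflexive (sym (trans (cong (_* n) (𝟙-yes (¬? (Typical? v)) ¬p)) (*-identityˡ n))))
        (≤-trans (m≤n+m _ b) (m≤n+m _ (k * f v)))

    Bad? : ∀ u v → Dec (G u v × ¬ a ≤ d u v + c)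
    Bad? u v = G? u v ×-dec ¬? (a ≤? d u v + c)

    B : ℕ
    B = ∑ (λ u → # (Bad? u))

    -- No shadow pair has codegree above a + b, and a bad one stays more than `c` below `a`. Each
    -- bad pair thus wastes `c` of the total budget (a + b)t available to `e`.
    deficiency : c * B + e ≤ (a + b) * t
    deficiency = begin
      c * B + e                                                   ≡⟨ cong (_+ e) (trans (∑-*ˡ c _) (∑-cong λ u → ∑-*ˡ c _)) ⟩
      ∑ (λ u → ∑ λ v → c * 𝟙 (Bad? u v)) + ∑ (λ u → ∑ (d u))      ≤⟨ ∑-+-≤ (λ u → ∑-+-≤ (pointwise u)) ⟩
      ∑ (λ u → ∑ λ v → (a + b) * 𝟙 (G? u v))                      ≡⟨ trans (∑-*ˡ (a + b) _) (∑-cong λ u → ∑-*ˡ (a + b) _) ⟨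
      (a + b) * t                                                 ∎
      where
      open ≤-Reasoning
      pointwise : ∀ u v → c * 𝟙 (Bad? u v) + d u v ≤ (a + b) * 𝟙 (G? u v)
      pointwise u v = [ adjacent , non-adjacent ]′ (toSum (G? u v))
        where
        adjacent : G u v → c * 𝟙 (Bad? u v) + d u v ≤ (a + b) * 𝟙 (G? u v)
        adjacent g = subst (λ z → c * 𝟙 (Bad? u v) + d u v ≤ (a + b) * z) (sym (𝟙-yes (G? u v) g))
          (≤-trans ([ bad , not-bad ]′ (toSum (Bad? u v))) (≤-reflexive (sym (*-identityʳ (a + b)))))
          where
          bad : G u v × ¬ a ≤ d u v + c → c * 𝟙 (Bad? u v) + d u v ≤ a + b
          bad p = subst (λ z → c * z + d u v ≤ a + b) (sym (𝟙-yes (Bad? u v) p)) (begin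
            c * 1 + d u v  ≡⟨ cong (_+ d u v) (*-identityʳ c) ⟩
            c + d u v      ≡⟨ +-comm c (d u v) ⟩
            d u v + c      ≤⟨ <⇒≤ (≰⇒> (proj₂ p)) ⟩
            a              ≤⟨ m≤m+n a b ⟩
            a + b          ∎)
          not-bad : ¬ (G u v × ¬ a ≤ d u v + c) → c * 𝟙 (Bad? u v) + d u v ≤ a + b
          not-bad ¬p = subst (λ z → c * z + d u v ≤ a + b) (sym (𝟙-no (Bad? u v) ¬p))
            (≤-trans (≤-reflexive (cong (_+ d u v) (*-zeroʳ c))) (d-upper u v))
        non-adjacent : ¬ G u v → c * 𝟙 (Bad? u v) + d u v ≤ (a + b) * 𝟙 (G? u v)
        non-adjacent ¬g = ≤-trans (≤-reflexive (begin-equality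
          c * 𝟙 (Bad? u v) + d u v  ≡⟨ cong₂ (λ y z → c * y + z) (𝟙-no (Bad? u v) (¬g ∘ proj₁))
                                         (#-none (h? u v) λ _ p → ¬g (h⇒G p)) ⟩
          c * 0 + 0                 ≡⟨ trans (+-identityʳ _) (*-zeroʳ c) ⟩
          0                         ∎)) z≤n

    -- The relative loss 1/(1 + η) on κn³ fits into (1 + b)n², because κn ≤ κN(1 + b) ≤ (1 + η)(1 +
    -- b).
    e-lower : κ * (n * n * n) ≤ k * k * e + (1 + b) * (n * n)
    e-lower = *-cancelˡ-≤ (1 + η) (edges-lower {η} {j} {n} {e} {b} edges-large (begin
      κ * n              ≤⟨ *-monoʳ-≤ κ (<⇒≤ n<N[1+b]) ⟩
      κ * (N * (1 + b))  ≡⟨ *-assoc κ N (1 + b) ⟨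
      κ * N * (1 + b)    ≤⟨ *-monoˡ-≤ (1 + b) κN≤1+η ⟩
      (1 + η) * (1 + b)  ∎))
      where
      open ≤-Reasoning
      instance
        N≢0 : NonZero N
        N≢0 = >-nonZero 1≤N
      κN≤1+η : κ * N ≤ 1 + η
      κN≤1+η = begin
        κ * N                ≤⟨ *-mono-≤ (m≤m*n κ κ) (≤-trans (m≤m*n N N) (m≤m*n (N * N) N)) ⟩
        κ * κ * (N * N * N)  ≤⟨ κ²N³≤η ⟩
        η                    ≤⟨ n≤1+n η ⟩
        1 + η                ∎

    cB-upper : c * B ≤ 7 * (b * (n * n))
    cB-upper = *-cancelˡ-≤ (k * k) (deficiency-bound {c} {B} {e} {a} {b} {t} {j} {n}
      deficiency t-upper ka≤n e-lower kb≤n 1≤b)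

    Many? : ∀ v → Dec (c < # (Bad? v))
    Many? v = suc c ≤? # (Bad? v)

    1≤c : 1 ≤ c
    1≤c = ≤-trans 1≤b (≤-trans (m≤n+m b _) 28Y²b+b≤c)

    few-many : # Many? ≤ 28 * (Y * Y) * b
    few-many = *-cancelˡ-≤ (c * c) {{>-nonZero (*-mono-≤ 1≤c 1≤c)}}
      (many-bad-bound {# Many?} {c} {B} {b} {n} {Y} (markov _ c) cB-upper (*-mono-≤ n≤2Yc n≤2Yc))

    W : Fin n → Set
    W v = Typical v × ¬ c < # (Bad? v)

    W? : ∀ v → Dec (W v)
    W? v = Typical? v ×-dec ¬? (Many? v)

    #W-small : # (λ v → ¬? (W? v)) ≤ c
    #W-small = begin
      # (λ v → ¬? (W? v))                        ≤⟨ #-cover (λ v → ¬? (W? v)) Many? (λ v → ¬? (Typical? v)) split ⟩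
      # Many? + # (λ v → ¬? (Typical? v))        ≤⟨ +-mono-≤ few-many few-atypical ⟩
      28 * (Y * Y) * b + b                       ≤⟨ 28Y²b+b≤c ⟩
      c                                          ∎
      where
      open ≤-Reasoning
      split : ∀ v → ¬ W v → c < # (Bad? v) ⊎ ¬ Typical v
      split v ¬w = [ inj₁ , (λ ¬m → inj₂ λ p → ¬w (p , ¬m)) ]′ (toSum (Many? v))

    #M-small : ∀ {v} → W v → f v ≤ a + c
    #M-small (p , _) = ≤-trans (f-upper p) (+-monoʳ-≤ a (≤-trans (m≤n+m b _) 28Y²b+b≤c))

    #bad-small : ∀ {v} → W v → # (Bad? v) ≤ c
    #bad-small (_ , ¬m) = ≮⇒≥ ¬m

  open import Data.List.Membership.Propositional using (find; lose) renaming (_∈_ to _∈ₗ_)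
  open import Data.List.Membership.Propositional.Properties using (∈-filter⁺; ∈-filter⁻; ∈-map⁺; ∈-map⁻; ∈-++⁺ˡ; ∈-++⁺ʳ)
  open import Data.List.Relation.Unary.All as All using (All; []; _∷_)
  import Data.List.Relation.Unary.All.Properties as All
  open import Data.List.Relation.Unary.Any as Any using (Any; here; there; any?)
  open import Data.List.Relation.Unary.Unique.Propositional using (Unique; []; _∷_)
  import Data.List.Relation.Unary.Unique.Propositional.Properties as Unique
  open import Data.Vec using ([]; _∷_)
  open import Data.Vec.Properties using (∷-injectiveʳ)

  -- Subsets with two and three elements

  _≢?_ : ∀ {n} (x y : Fin n) → Dec (x ≢ y)
  x ≢? y = ¬? (x Fin.≟ y)

  ∣p∣≡# : ∀ {n} (p : Subset n) → ∣ p ∣ ≡ # (_∈? p)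
  ∣p∣≡# []            = sym (∑-zero (λ i → 𝟙 (i ∈? [])))
  ∣p∣≡# (inside ∷ p)  = trans (cong suc (∣p∣≡# p)) (sym (∑-suc λ i → 𝟙 (i ∈? inside ∷ p)))
  ∣p∣≡# (outside ∷ p) = trans (∣p∣≡# p) (sym (∑-suc λ i → 𝟙 (i ∈? outside ∷ p)))

  #-delete : ∀ {n} {P : Fin n → Set} (P? : ∀ i → Dec (P i)) x → # P? ≤ suc (# (λ i → P? i ×-dec i ≢? x))
  #-delete {P = P} P? x = ≤-trans (#-cover P? (λ i → P? i ×-dec i ≢? x) (Fin._≟ x) split)
    (≤-trans (+-monoʳ-≤ _ (#-subsingleton (Fin._≟ x) λ i j p q → trans p (sym q))) (≤-reflexive (+-comm _ 1)))
    where
    split : ∀ i → P i → (P i × i ≢ x) ⊎ i ≡ x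
    split i p = [ inj₂ , (λ i≢x → inj₁ (p , i≢x)) ]′ (toSum (i Fin.≟ x))

  #-delete-≥ : ∀ {n} {P : Fin n → Set} (P? : ∀ i → Dec (P i)) x → P x → suc (# (λ i → P? i ×-dec i ≢? x)) ≤ # P?
  #-delete-≥ P? x p = #-insert P? (λ i → P? i ×-dec i ≢? x) x p (λ (_ , x≢x) → x≢x refl) λ _ → proj₁

  module _ {n : ℕ} (p : Subset n) where
    other? : ∀ x i → Dec (i ∈ p × i ≢ x)
    other? x i = i ∈? p ×-dec i ≢? x

    other₂? : ∀ x y i → Dec ((i ∈ p × i ≢ x) × i ≢ y)
    other₂? x y i = other? x i ×-dec i ≢? y

    pair-members : ∣ p ∣ ≡ 2 → ∀ {x y z} → x ∈ p → y ∈ p → x ≢ y → z ∈ p → z ≡ x ⊎ z ≡ y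
    pair-members ∣p∣≡2 {x} {y} {z} x∈p y∈p x≢y z∈p with z Fin.≟ x | z Fin.≟ y
    ... | yes z≡x | _       = inj₁ z≡x
    ... | no _    | yes z≡y = inj₂ z≡y
    ... | no z≢x  | no z≢y  = ⊥-elim (n≮n 2 (≤-trans
      (s≤s (≤-trans (s≤s (#-inhabited (other₂? x y) z ((z∈p , z≢x) , z≢y)))
        (#-delete-≥ (other? x) y (y∈p , x≢y ∘ sym))))
      (≤-trans (#-delete-≥ (_∈? p) x x∈p) (≤-reflexive (trans (sym (∣p∣≡# p)) ∣p∣≡2)))))

    triple-members : ∣ p ∣ ≡ 3 → ∀ {x y z w} → x ∈ p → y ∈ p → z ∈ p → x ≢ y → x ≢ z → y ≢ z → w ∈ p →
      w ≡ x ⊎ w ≡ y ⊎ w ≡ z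
    triple-members ∣p∣≡3 {x} {y} {z} {w} x∈p y∈p z∈p x≢y x≢z y≢z w∈p with w Fin.≟ x | w Fin.≟ y | w Fin.≟ z
    ... | yes w≡x | _       | _       = inj₁ w≡x
    ... | no _    | yes w≡y | _       = inj₂ (inj₁ w≡y)
    ... | no _    | no _    | yes w≡z = inj₂ (inj₂ w≡z)
    ... | no w≢x  | no w≢y  | no w≢z  = ⊥-elim (n≮n 3 (≤-trans
      (s≤s (≤-trans (s≤s (≤-trans (s≤s (#-inhabited (λ i → other₂? x y i ×-dec i ≢? z) w (((w∈p , w≢x) , w≢y) , w≢z)))
        (#-delete-≥ (other₂? x y) z ((z∈p , x≢z ∘ sym) , y≢z ∘ sym))))
        (#-delete-≥ (other? x) y (y∈p , x≢y ∘ sym))))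
      (≤-trans (#-delete-≥ (_∈? p) x x∈p) (≤-reflexive (trans (sym (∣p∣≡# p)) ∣p∣≡3)))))

  Pair : ∀ {n} → Subset n → Fin n → Fin n → Set
  Pair p x y = x ≢ y × x ∈ p × y ∈ p

  Pair? : ∀ {n} (p : Subset n) x y → Dec (Pair p x y)
  Pair? p x y = x ≢? y ×-dec x ∈? p ×-dec y ∈? p

  Triple : ∀ {n} → Subset n → Fin n → Fin n → Fin n → Set
  Triple p x y z = (x ≢ y × x ≢ z × y ≢ z) × x ∈ p × y ∈ p × z ∈ p

  Triple? : ∀ {n} (p : Subset n) x y z → Dec (Triple p x y z)
  Triple? p x y z = (x ≢? y ×-dec x ≢? z ×-dec y ≢? z) ×-dec x ∈? p ×-dec y ∈? p ×-dec z ∈? p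

  Triple-members : ∀ {n} (p : Subset n) → ∣ p ∣ ≡ 3 → ∀ {x y z w} → Triple p x y z → w ∈ p → w ≡ x ⊎ w ≡ y ⊎ w ≡ z
  Triple-members p ∣p∣≡3 ((x≢y , x≢z , y≢z) , x∈p , y∈p , z∈p) = triple-members p ∣p∣≡3 x∈p y∈p z∈p x≢y x≢z y≢z

  Pair⇒≡ : ∀ {n} {p q : Subset n} {x y} → ∣ p ∣ ≡ 2 → ∣ q ∣ ≡ 2 → Pair p x y → Pair q x y → p ≡ q
  Pair⇒≡ {n} {p} {q} ∣p∣ ∣q∣ s t = ⊆-antisym (sub {p} {q} ∣p∣ s t) (sub {q} {p} ∣q∣ t s)
    where
    sub : ∀ {p q : Subset n} {x y} → ∣ p ∣ ≡ 2 → Pair p x y → Pair q x y → p ⊆ q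
    sub {p} ∣p∣ (x≢y , x∈p , y∈p) (_ , x∈q , y∈q) z∈p with pair-members p ∣p∣ x∈p y∈p x≢y z∈p
    ... | inj₁ refl = x∈q
    ... | inj₂ refl = y∈q

  Triple⇒≡ : ∀ {n} {p q : Subset n} {x y z} → ∣ p ∣ ≡ 3 → ∣ q ∣ ≡ 3 → Triple p x y z → Triple q x y z → p ≡ q
  Triple⇒≡ {n} {p} {q} ∣p∣ ∣q∣ s t = ⊆-antisym (sub {p} {q} ∣p∣ s t) (sub {q} {p} ∣q∣ t s)
    where
    sub : ∀ {p q : Subset n} {x y z} → ∣ p ∣ ≡ 3 → Triple p x y z → Triple q x y z → p ⊆ q
    sub {p} ∣p∣ s (_ , x∈q , y∈q , z∈q) w∈p with Triple-members p ∣p∣ s w∈p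
    ... | inj₁ refl        = x∈q
    ... | inj₂ (inj₁ refl) = y∈q
    ... | inj₂ (inj₂ refl) = z∈q

  -- The pair is counted in both orders. A lower bound is what is wanted: it carries the assumed
  -- density of the shadow over to the count of ordered adjacent pairs.
  #-Pair : ∀ {n} (p : Subset n) → ∣ p ∣ ≡ 2 → 2 ≤ ∑ λ x → # (Pair? p x)
  #-Pair p ∣p∣ = begin
    2                                ≡⟨ trans (*-identityʳ _) (trans (sym (∣p∣≡# p)) ∣p∣) ⟨
    # (_∈? p) * 1                    ≡⟨ ∑-*ʳ 1 _ ⟩
    ∑ (λ x → 𝟙 (x ∈? p) * 1)         ≤⟨ ∑-mono (λ x → 𝟙-*-≤ (x ∈? p) λ x∈p → ≤-trans
                                          (≤-pred (≤-trans (≤-reflexive (trans (sym ∣p∣) (∣p∣≡# p))) (#-delete (_∈? p) x)))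
                                          (#-mono (other? p x) (Pair? p x) λ y (y∈p , y≢x) → y≢x ∘ sym , x∈p , y∈p)) ⟩
    ∑ (λ x → # (Pair? p x))          ∎
    where open ≤-Reasoning

  #-Triple : ∀ {n} (p : Subset n) → ∣ p ∣ ≡ 3 → 6 ≤ ∑³ λ x y z → 𝟙 (Triple? p x y z)
  #-Triple p ∣p∣ = begin
    6                                ≡⟨ cong (_* 2) (trans (sym (∣p∣≡# p)) ∣p∣) ⟨
    # (_∈? p) * 2                    ≡⟨ ∑-*ʳ 2 _ ⟩
    ∑ (λ x → 𝟙 (x ∈? p) * 2)         ≤⟨ ∑-mono (λ x → 𝟙-*-≤ (x ∈? p) (second x)) ⟩
    ∑³ (λ x y z → 𝟙 (Triple? p x y z)) ∎
    where
    open ≤-Reasoning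
    #₁ : ∀ x → 2 ≤ # (other? p x)
    #₁ x = ≤-pred (≤-trans (≤-reflexive (trans (sym ∣p∣) (∣p∣≡# p))) (#-delete (_∈? p) x))
    #₂ : ∀ x y → 1 ≤ # (other₂? p x y)
    #₂ x y = ≤-pred (≤-trans (#₁ x) (#-delete (other? p x) y))
    third : ∀ x → x ∈ p → ∀ y → y ∈ p × y ≢ x → 1 ≤ # (Triple? p x y)
    third x x∈p y (y∈p , y≢x) = ≤-trans (#₂ x y) (#-mono (other₂? p x y) (Triple? p x y)
      λ z ((z∈p , z≢x) , z≢y) → (y≢x ∘ sym , z≢x ∘ sym , z≢y ∘ sym) , x∈p , y∈p , z∈p)
    second : ∀ x → x ∈ p → 2 ≤ ∑ λ y → # (Triple? p x y)
    second x x∈p = begin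
      2                                          ≤⟨ #₁ x ⟩
      # (other? p x)                      ≡⟨ *-identityʳ _ ⟨
      # (other? p x) * 1                  ≡⟨ ∑-*ʳ 1 _ ⟩
      ∑ (λ y → 𝟙 (other? p x y) * 1)              ≤⟨ ∑-mono (λ y → 𝟙-*-≤ (other? p x y) (third x x∈p y)) ⟩
      ∑ (λ y → # (Triple? p x y))                ∎

  module _ {n : ℕ} where
    Pairs? : (ps : List (Subset n)) → ∀ x y → Dec (Any (λ p → Pair p x y) ps)
    Pairs? ps x y = any? (λ p → Pair? p x y) ps

    Triples? : (ps : List (Subset n)) → ∀ x y z → Dec (Any (λ p → Triple p x y z) ps)
    Triples? ps x y z = any? (λ p → Triple? p x y z) ps

    #-Pairs : (ps : List (Subset n)) → Unique ps → All (λ p → ∣ p ∣ ≡ 2) ps →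
      length ps * 2 ≤ ∑ λ x → # (Pairs? ps x)
    #-Pairs []       _          _              = z≤n
    #-Pairs (p ∷ ps) (p∉ ∷ uniq) (∣p∣ ∷ ∣ps∣) = ≤-trans (+-mono-≤ (#-Pair p ∣p∣) (#-Pairs ps uniq ∣ps∣))
      (∑-+-≤ λ x → #-disjoint (Pair? p x) (Pairs? ps x) (Pairs? (p ∷ ps) x) (λ _ → here) (λ _ → there) disjoint)
      where
      disjoint : ∀ {x} y → Pair p x y → Any (λ q → Pair q x y) ps → ⊥
      disjoint y s any = let q , q∈ps , t = find any in All.lookup p∉ q∈ps (Pair⇒≡ ∣p∣ (All.lookup ∣ps∣ q∈ps) s t)

    #-Triples : (ps : List (Subset n)) → Unique ps → All (λ p → ∣ p ∣ ≡ 3) ps →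
      length ps * 6 ≤ ∑³ λ x y z → 𝟙 (Triples? ps x y z)
    #-Triples []       _          _              = z≤n
    #-Triples (p ∷ ps) (p∉ ∷ uniq) (∣p∣ ∷ ∣ps∣) = ≤-trans (+-mono-≤ (#-Triple p ∣p∣) (#-Triples ps uniq ∣ps∣))
      (∑-+-≤ λ x → ∑-+-≤ λ y → #-disjoint (Triple? p x y) (Triples? ps x y) (Triples? (p ∷ ps) x y)
        (λ _ → here) (λ _ → there) disjoint)
      where
      disjoint : ∀ {x y} z → Triple p x y z → Any (λ q → Triple q x y z) ps → ⊥
      disjoint z s any = let q , q∈ps , t = find any in All.lookup p∉ q∈ps (Triple⇒≡ ∣p∣ (All.lookup ∣ps∣ q∈ps) s t)

  ∈-allSubsets : ∀ {n} (p : Subset n) → p ∈ₗ allSubsets n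
  ∈-allSubsets []            = here refl
  ∈-allSubsets (outside ∷ p) = ∈-++⁺ˡ (∈-map⁺ (outside ∷_) (∈-allSubsets p))
  ∈-allSubsets (inside ∷ p)  = ∈-++⁺ʳ (List.map (outside ∷_) (allSubsets _)) (∈-map⁺ (inside ∷_) (∈-allSubsets p))

  allSubsets-unique : ∀ n → Unique (allSubsets n)
  allSubsets-unique zero    = [] ∷ []
  allSubsets-unique (suc n) = Unique.++⁺ (Unique.map⁺ ∷-injectiveʳ (allSubsets-unique n))
    (Unique.map⁺ ∷-injectiveʳ (allSubsets-unique n)) disjoint
    where
    disjoint : ∀ {p} → p ∈ₗ List.map (outside ∷_) (allSubsets n) × p ∈ₗ List.map (inside ∷_) (allSubsets n) → ⊥
    disjoint (s , t) with ∈-map⁻ (outside ∷_) s | ∈-map⁻ (inside ∷_) t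
    ... | _ , _ , refl | _ , _ , ()

  triple : ∀ {n} → Fin n → Fin n → Fin n → Subset n
  triple x y z = ⁅ x ⁆ ∪ ⁅ y ⁆ ∪ ⁅ z ⁆

  ∈-triple⁻ : ∀ {n} {x y z w : Fin n} → w ∈ triple x y z → w ≡ x ⊎ w ≡ y ⊎ w ≡ z
  ∈-triple⁻ {x = x} {y} {z} w∈ with x∈p∪q⁻ ⁅ x ⁆ (⁅ y ⁆ ∪ ⁅ z ⁆) w∈
  ... | inj₁ w∈x  = inj₁ (x∈⁅y⁆⇒x≡y x w∈x)
  ... | inj₂ w∈yz = inj₂ (Sum.map (x∈⁅y⁆⇒x≡y y) (x∈⁅y⁆⇒x≡y z) (x∈p∪q⁻ ⁅ y ⁆ ⁅ z ⁆ w∈yz))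

  Triple-triple : ∀ {n} {x y z : Fin n} → x ≢ y → x ≢ z → y ≢ z → Triple (triple x y z) x y z
  Triple-triple {x = x} {y} {z} x≢y x≢z y≢z = (x≢y , x≢z , y≢z) , x∈p∪q⁺ (inj₁ (x∈⁅x⁆ x)) ,
    x∈p∪q⁺ (inj₂ (x∈p∪q⁺ (inj₁ (x∈⁅x⁆ y)))) , x∈p∪q⁺ {p = ⁅ x ⁆} (inj₂ (x∈p∪q⁺ {p = ⁅ y ⁆} (inj₂ (x∈⁅x⁆ z))))

  ∣triple∣ : ∀ {n} {x y z : Fin n} → x ≢ y → x ≢ z → y ≢ z → ∣ triple x y z ∣ ≡ 3
  ∣triple∣ {x = x} {y} {z} x≢y x≢z y≢z with Triple-triple x≢y x≢z y≢z
  ... | _ , x∈ , y∈ , z∈ = trans (∣p∣≡# p) (≤-antisym upper lower)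
    where
    p = triple x y z
    lower : 3 ≤ # (_∈? p)
    lower = ≤-trans (s≤s (≤-trans (s≤s (#-inhabited (other₂? p x y) z ((z∈ , x≢z ∘ sym) , y≢z ∘ sym)))
      (#-delete-≥ (other? p x) y (y∈ , x≢y ∘ sym)))) (#-delete-≥ (_∈? p) x x∈)
    none : ∀ i → ¬ (((i ∈ p × i ≢ x) × i ≢ y) × i ≢ z)
    none i (((i∈ , i≢x) , i≢y) , i≢z) = [ i≢x , [ i≢y , i≢z ]′ ]′ (∈-triple⁻ i∈)
    upper : # (_∈? p) ≤ 3
    upper = ≤-trans (#-delete (_∈? p) x) (s≤s (≤-trans (#-delete (other? p x) y)
      (s≤s (≤-trans (#-delete (other₂? p x y) z)
        (s≤s (≤-reflexive (#-none (λ i → other₂? p x y i ×-dec i ≢? z) none)))))))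

  -- Graphs and colorings

  Triple-swap : ∀ {n} {p : Subset n} {x y z} → Triple p x y z → Triple p y x z
  Triple-swap ((x≢y , x≢z , y≢z) , x∈ , y∈ , z∈) = (x≢y ∘ sym , y≢z , x≢z) , y∈ , x∈ , z∈

  Triple-rotate : ∀ {n} {p : Subset n} {x y z} → Triple p x y z → Triple p y z x
  Triple-rotate ((x≢y , x≢z , y≢z) , x∈ , y∈ , z∈) = (y≢z , x≢y ∘ sym , x≢z ∘ sym) , y∈ , z∈ , x∈

  Triple⇒Pair : ∀ {n} {p : Subset n} {x y z} → Triple p x y z → Pair p x y
  Triple⇒Pair ((x≢y , _) , x∈ , y∈ , _) = x≢y , x∈ , y∈

  Triple-∉ : ∀ {n} {p : Subset n} {x y z w} → ∣ p ∣ ≡ 3 → Triple p x y z → x ≢ w → y ≢ w → z ≢ w → w ∉ p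
  Triple-∉ {p = p} ∣p∣ s x≢w y≢w z≢w w∈p with Triple-members p ∣p∣ s w∈p
  ... | inj₁ refl        = x≢w refl
  ... | inj₂ (inj₁ refl) = y≢w refl
  ... | inj₂ (inj₂ refl) = z≢w refl

  module _ {n : ℕ} (H : Graph3 n) where
    Edge : Fin n → Fin n → Fin n → Set
    Edge x y z = Any (λ e → Triple e x y z) (edges H)

    Edge? : ∀ x y z → Dec (Edge x y z)
    Edge? = Triples? (edges H)

    Adjacent : Fin n → Fin n → Set
    Adjacent x y = Any (λ e → Pair e x y) (edges H)

    Adjacent? : ∀ x y → Dec (Adjacent x y)
    Adjacent? = Pairs? (edges H)

    Edge⇒Adjacent : ∀ {x y z} → Edge x y z → Adjacent x y
    Edge⇒Adjacent = Any.map λ {e} → Triple⇒Pair {p = e}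

    Adjacent-sym : ∀ {x y} → Adjacent x y → Adjacent y x
    Adjacent-sym = Any.map λ (x≢y , x∈ , y∈) → x≢y ∘ sym , y∈ , x∈

    -- With A = uvw, B = uvw′ and C an edge through w and w′, the symmetric difference of A and B is
    -- {w, w′}, inside C. The three edges differ because A misses w′ and B misses w, while C
    -- contains both.
    cancellative⇒independent : Cancellative H → ∀ {u v w w′} → Edge u v w → Edge u v w′ → ¬ Adjacent w w′
    cancellative⇒independent canc {u} {v} {w} {w′} uvw uvw′ ww′ =
      let A , A∈ , s@((u≢v , u≢w , v≢w) , u∈A , v∈A , w∈A) = find uvw
          B , B∈ , t@((_ , u≢w′ , v≢w′) , u∈B , v∈B , w′∈B) = find uvw′
          C , C∈ , w≢w′ , w∈C , w′∈C = find ww′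
          ∣A∣ = All.lookup (uniform H) A∈
          ∣B∣ = All.lookup (uniform H) B∈
          w′∉A = Triple-∉ {p = A} ∣A∣ s u≢w′ v≢w′ w≢w′
          w∉B = Triple-∉ {p = B} ∣B∣ t u≢w v≢w (w≢w′ ∘ sym)
          △⊆C : (A △ B) ⊆ C
          △⊆C {x} x∈△ =
            let x∈∪ , x∈∁ = x∈p∩q⁻ (A ∪ B) (∁ (A ∩ B)) x∈△
                x∉∩ = λ q → x∈∁p⇒x∉p x∈∁ (x∈p∩q⁺ q)
                from-A : x ≡ u ⊎ x ≡ v ⊎ x ≡ w → x ∈ C
                from-A = λ { (inj₁ refl) → ⊥-elim (x∉∩ (u∈A , u∈B))
                           ; (inj₂ (inj₁ refl)) → ⊥-elim (x∉∩ (v∈A , v∈B))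
                           ; (inj₂ (inj₂ refl)) → w∈C }
                from-B : x ≡ u ⊎ x ≡ v ⊎ x ≡ w′ → x ∈ C
                from-B = λ { (inj₁ refl) → ⊥-elim (x∉∩ (u∈A , u∈B))
                           ; (inj₂ (inj₁ refl)) → ⊥-elim (x∉∩ (v∈A , v∈B))
                           ; (inj₂ (inj₂ refl)) → w′∈C }
            in [ from-A ∘ Triple-members A ∣A∣ s , from-B ∘ Triple-members B ∣B∣ t ]′ (x∈p∪q⁻ A B x∈∪)
      in canc A B C A∈ B∈ C∈ (λ A≡B → w′∉A (subst (w′ ∈_) (sym A≡B) w′∈B))
        (λ B≡C → w∉B (subst (w ∈_) (sym B≡C) w∈C)) (λ A≡C → w′∉A (subst (w′ ∈_) (sym A≡C) w′∈C)) △⊆C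

    size-≤-Edge : size H * 6 ≤ ∑³ λ x y z → 𝟙 (Edge? x y z)
    size-≤-Edge = #-Triples (edges H) (unique H) (uniform H)

    InShadow? : ∀ (p : Subset n) → Dec (∣ p ∣ ≡ 2 × Any (p ⊆_) (edges H))
    InShadow? p = (∣ p ∣ ℕ.≟ 2) ×-dec any? (p ⊆?_) (edges H)

    shadowSize-≤-Adjacent : shadowSize H * 2 ≤ ∑ λ x → # (Adjacent? x)
    shadowSize-≤-Adjacent = ≤-trans
      (#-Pairs (shadow H) (Unique.filter⁺ InShadow? (allSubsets-unique n))
        (All.map proj₁ (All.all-filter InShadow? (allSubsets n))))
      (∑-mono λ x → #-mono (Pairs? (shadow H) x) (Adjacent? x) λ y any →
        let p , p∈ , x≢y , x∈p , y∈p = find any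
            _ , _ , p⊆ = ∈-filter⁻ InShadow? {xs = allSubsets n} p∈
        in Any.map (λ p⊆e → x≢y , p⊆e x∈p , p⊆e y∈p) p⊆)

  -- The Steiner triple system of the classes and the surviving edges

  length-filter-¬ : ∀ {A : Set} {P : A → Set} (P? : ∀ x → Dec (P x)) xs →
    length xs ≡ length (filter P? xs) + length (filter (¬? ∘ P?) xs)
  length-filter-¬ P? []       = refl
  length-filter-¬ P? (x ∷ xs) with P? x
  ... | yes _ = cong suc (length-filter-¬ P? xs)
  ... | no _  = trans (cong suc (length-filter-¬ P? xs)) (sym (+-suc _ _))

  pair-elements : ∀ {n} (p : Subset n) → ∣ p ∣ ≡ 2 → ∃₂ λ x y → Pair p x y
  pair-elements p ∣p∣ =
    let 2≤# = ≤-reflexive (trans (sym ∣p∣) (∣p∣≡# p))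
        x , x∈p , _ = pick {Q = λ _ → ⊥} (_∈? p) (λ _ → no λ ())
          (≤-trans (s≤s (≤-reflexive (#-none {P = λ _ → ⊥} (λ _ → no λ ()) λ _ ()))) (≤-trans (s≤s z≤n) 2≤#))
        y , y∈p , y≢x = pick (_∈? p) (Fin._≟ x)
          (≤-trans (s≤s (#-subsingleton (Fin._≟ x) λ i j p q → trans p (sym q))) 2≤#)
    in x , y , y≢x ∘ sym , x∈p , y∈p

  -- `φ-exists` and `φ-unique` are the two halves of the Steiner property, expressed through
  -- vertices of `H`; `few-lost` bounds the edges to be removed.
  record Partition {n : ℕ} (H : Graph3 n) (k c : ℕ) : Set₁ where
    field
      Good       : Fin n → Fin n → Fin n → Set
      Good?      : ∀ u v w → Dec (Good u v w)
      Good-swap  : ∀ {u v w} → Good u v w → Good v u w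
      Good-swap₂ : ∀ {u v w} → Good u v w → Good u w v
      φ          : Fin n → Fin k
      φ-distinct : ∀ {u v w} → Good u v w → φ u ≢ φ v
      φ-unique   : ∀ {u v w u′ v′ w′} → Good u v w → Good u′ v′ w′ → φ u ≡ φ u′ → φ v ≡ φ v′ → φ w ≡ φ w′
      φ-exists   : ∀ {i j} → i ≢ j → ∃ λ u → ∃ λ v → ∃ λ w → Good u v w × φ u ≡ i × φ v ≡ j
      few-lost   : ∑³ (λ x y z → 𝟙 (Edge? H x y z ×-dec ¬? (Good? x y z))) ≤ 6 * (n * (n * c))

  module Coloring {n k c : ℕ} (H : Graph3 n) (partition : Partition H k c) where
    open Partition partition

    Block : Subset k → Fin n → Fin n → Fin n → Set
    Block E u v w = Good u v w × φ u ∈ E × φ v ∈ E × φ w ∈ E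

    Block⇒Triple : ∀ {E u v w} → Block E u v w → Triple E (φ u) (φ v) (φ w)
    Block⇒Triple (g , m) = (φ-distinct g , φ-distinct (Good-swap₂ g) , φ-distinct (Good-swap₂ (Good-swap g))) , m

    block : ∀ {u v w} → Good u v w → Block (triple (φ u) (φ v) (φ w)) u v w
    block g = g , proj₂ (Triple-triple (φ-distinct g) (φ-distinct (Good-swap₂ g)) (φ-distinct (Good-swap₂ (Good-swap g))))

    ∣block∣ : ∀ {u v w} → Good u v w → ∣ triple (φ u) (φ v) (φ w) ∣ ≡ 3
    ∣block∣ g = ∣triple∣ (φ-distinct g) (φ-distinct (Good-swap₂ g)) (φ-distinct (Good-swap₂ (Good-swap g)))

    -- A good triple has three distinct classes, so a three-element set containing them is exactly
    -- the set of these classes.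
    IsBlock : Subset k → Set
    IsBlock E = ∣ E ∣ ≡ 3 × ∃ λ u → ∃ λ v → ∃ λ w → Block E u v w

    IsBlock? : ∀ E → Dec (IsBlock E)
    IsBlock? E = (∣ E ∣ ℕ.≟ 3) ×-dec Fin.any? λ u → Fin.any? λ v → Fin.any? λ w →
      Good? u v w ×-dec φ u ∈? E ×-dec φ v ∈? E ×-dec φ w ∈? E

    S : Graph3 k
    S = record
      { edges   = filter IsBlock? (allSubsets k)
      ; unique  = Unique.filter⁺ IsBlock? (allSubsets-unique k)
      ; uniform = All.map proj₁ (All.all-filter IsBlock? (allSubsets k))
      }

    block∈S : ∀ {u v w} → Good u v w → triple (φ u) (φ v) (φ w) ∈ₗ edges S
    block∈S {u} {v} {w} g = ∈-filter⁺ IsBlock? (∈-allSubsets _) (∣block∣ g , u , v , w , block g)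

    -- Goodness is invariant under permutations, so the triple behind a block can be reordered until
    -- two prescribed classes come first, the form in which `φ-unique` applies.
    align : ∀ {E i j} → IsBlock E → i ∈ E → j ∈ E → i ≢ j →
      ∃ λ u → ∃ λ v → ∃ λ w → Block E u v w × φ u ≡ i × φ v ≡ j
    align {E} {i} {j} (∣E∣ , u , v , w , b) i∈E j∈E i≢j = first b (Triple-members E ∣E∣ (Block⇒Triple {E} b) i∈E)
      where
      second : ∀ {u v w} → Block E u v w → φ u ≡ i → j ≡ φ u ⊎ j ≡ φ v ⊎ j ≡ φ w →
        ∃ λ u → ∃ λ v → ∃ λ w → Block E u v w × φ u ≡ i × φ v ≡ j
      second b p (inj₁ q) = ⊥-elim (i≢j (sym (trans q p)))
      second b p (inj₂ (inj₁ q)) = _ , _ , _ , b , p , sym q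
      second (g , u∈ , v∈ , w∈) p (inj₂ (inj₂ q)) = _ , _ , _ , (Good-swap₂ g , u∈ , w∈ , v∈) , p , sym q
      next : ∀ {u v w} → Block E u v w → φ u ≡ i → ∃ λ u → ∃ λ v → ∃ λ w → Block E u v w × φ u ≡ i × φ v ≡ j
      next b p = second b p (Triple-members E ∣E∣ (Block⇒Triple {E} b) j∈E)
      first : ∀ {u v w} → Block E u v w → i ≡ φ u ⊎ i ≡ φ v ⊎ i ≡ φ w →
        ∃ λ u → ∃ λ v → ∃ λ w → Block E u v w × φ u ≡ i × φ v ≡ j
      first b (inj₁ p) = next b (sym p)
      first (g , u∈ , v∈ , w∈) (inj₂ (inj₁ p)) = next (Good-swap g , v∈ , u∈ , w∈) (sym p)
      first (g , u∈ , v∈ , w∈) (inj₂ (inj₂ p)) = next (Good-swap (Good-swap₂ g) , w∈ , u∈ , v∈) (sym p)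

    S-isSTS : IsSTS S
    S-isSTS P ∣P∣ =
      let i , j , i≢j , i∈P , j∈P = pair-elements P ∣P∣
          u , v , w , g , φu≡i , φv≡j = φ-exists i≢j
          E = triple (φ u) (φ v) (φ w)
          t , u∈E , v∈E , w∈E = Block⇒Triple {E} (block g)
          i∈E = subst (_∈ E) φu≡i u∈E
          j∈E = subst (_∈ E) φv≡j v∈E
          P⊆E : P ⊆ E
          P⊆E x∈P = [ (λ x≡i → subst (_∈ E) (sym x≡i) i∈E) , (λ x≡j → subst (_∈ E) (sym x≡j) j∈E) ]′
            (pair-members P ∣P∣ i∈P j∈P i≢j x∈P)
          only : ∀ E′ → E′ ∈ₗ edges S → P ⊆ E′ → E′ ≡ E
          only E′ E′∈S P⊆E′ =
            let isB@(∣E′∣ , _) = proj₂ (∈-filter⁻ IsBlock? {xs = allSubsets k} E′∈S)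
                u′ , v′ , w′ , (g′ , _ , _ , w′∈E′) , φu′≡i , φv′≡j = align isB (P⊆E′ i∈P) (P⊆E′ j∈P) i≢j
                φw′≡φw = φ-unique g′ g (trans φu′≡i (sym φu≡i)) (trans φv′≡j (sym φv≡j))
            in Triple⇒≡ {p = E′} {E} ∣E′∣ (∣block∣ g)
              (t , subst (_∈ E′) (sym φu≡i) (P⊆E′ i∈P) , subst (_∈ E′) (sym φv≡j) (P⊆E′ j∈P) , subst (_∈ E′) φw′≡φw w′∈E′)
              (t , u∈E , v∈E , w∈E)
      in E , block∈S g , P⊆E , only

    GoodEdge : Subset n → Set
    GoodEdge e = ∃ λ u → ∃ λ v → ∃ λ w → Good u v w × Triple e u v w

    GoodEdge? : ∀ e → Dec (GoodEdge e)
    GoodEdge? e = Fin.any? λ u → Fin.any? λ v → Fin.any? λ w → Good? u v w ×-dec Triple? e u v w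

    H′ : Graph3 n
    H′ = record
      { edges   = filter GoodEdge? (edges H)
      ; unique  = Unique.filter⁺ GoodEdge? (unique H)
      ; uniform = All.filter⁺ GoodEdge? (uniform H)
      }

    H′⊆H : SubGraph H′ H
    H′⊆H e e∈ = proj₁ (∈-filter⁻ GoodEdge? {xs = edges H} e∈)

    H′-colorable : Colorable H′ S
    H′-colorable = φ , λ e e∈ →
      let e∈H , u , v , w , g , s@(_ , u∈ , v∈ , w∈) = ∈-filter⁻ GoodEdge? {xs = edges H} e∈
          F = triple (φ u) (φ v) (φ w)
          _ , u∈F , v∈F , w∈F = block g
          into : ∀ {j} → j ∈ F → ∃ λ i → i ∈ e × φ i ≡ j
          into j∈F = [ (λ p → u , u∈ , sym p) , [ (λ p → v , v∈ , sym p) , (λ p → w , w∈ , sym p) ]′ ]′ (∈-triple⁻ j∈F)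
          onto : ∀ {j} → (∃ λ i → i ∈ e × φ i ≡ j) → j ∈ F
          onto = λ (i , i∈e , φi≡j) → subst (_∈ F) φi≡j
            ([ (λ p → subst (λ z → φ z ∈ F) (sym p) u∈F) , [ (λ p → subst (λ z → φ z ∈ F) (sym p) v∈F)
             , (λ p → subst (λ z → φ z ∈ F) (sym p) w∈F) ]′ ]′ (Triple-members e (All.lookup (uniform H) e∈H) s i∈e))
      in F , block∈S g , λ j → mk⇔ into onto

    lost : ℕ
    lost = length (filter (¬? ∘ GoodEdge?) (edges H))

    size-H : size H ≡ size H′ + lost
    size-H = length-filter-¬ GoodEdge? (edges H)

    -- Each removed edge accounts for six ordered triples, which cancels the six reasons in
    -- `few-lost`.
    lost-bound : lost ≤ n * (n * c)
    lost-bound = *-cancelˡ-≤ {lost} {n * (n * c)} 6 (≤-trans (≤-reflexive (*-comm 6 lost)) (≤-trans count few-lost))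
      where
      lostEdges = filter (¬? ∘ GoodEdge?) (edges H)
      count : lost * 6 ≤ ∑³ λ x y z → 𝟙 (Edge? H x y z ×-dec ¬? (Good? x y z))
      count = ≤-trans (#-Triples lostEdges (Unique.filter⁺ (¬? ∘ GoodEdge?) (unique H))
          (All.filter⁺ (¬? ∘ GoodEdge?) (uniform H)))
        (∑³-mono λ x y z → 𝟙-mono (Triples? lostEdges x y z) (Edge? H x y z ×-dec ¬? (Good? x y z)) λ any →
          let e , e∈ , s = find any
              e∈H , ¬good = ∈-filter⁻ (¬? ∘ GoodEdge?) {xs = edges H} e∈
          in lose e∈H s , λ g → ¬good (x , y , z , g , s))

  -- Choice of the constants and scales

  m<n*[1+m/n] : ∀ m n .{{_ : NonZero n}} → m < n * (1 + m / n)
  m<n*[1+m/n] m n = begin-strict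
    m                            ≡⟨ m≡m%n+[m/n]*n m n ⟩
    m % n + m / n * n      <⟨ +-monoˡ-< (m / n * n) (m%n<n m n) ⟩
    (1 + m / n) * n        ≡⟨ *-comm (1 + m / n) n ⟩
    n * (1 + m / n)        ∎
    where open ≤-Reasoning

  n*[m/n]≤m : ∀ m n .{{_ : NonZero n}} → n * (m / n) ≤ m
  n*[m/n]≤m m n = ≤-trans (≤-reflexive (*-comm n (m / n))) (m/n*n≤m m n)

  -- b = n / N is the scale of the deviations and c = 64 Y² b that of the exceptional sets,
  -- so that c is a fraction 1 / Y of n up to rounding.
  module Main (j D : ℕ) where
    k κ : ℕ
    k = 2 + j
    κ = 1 + j

    opaque
      Y N η : ℕ
      -- As `c` is at most n/Y, the summand 30k² keeps `c` below n/k divided by 30k, and `D` keeps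
      -- n²c below n³/D.
      Y = 30 * (k * k) + D
      N = 64 * (Y * Y * Y)
      -- 1/(1 + η) has to outweigh the factor κ² of the variance bound and the cube that counts
      -- atypical vertices at resolution 1/N.
      η = κ * κ * (N * N * N)

      30k²≤Y : 30 * (k * k) ≤ Y
      30k²≤Y = m≤m+n (30 * (k * k)) D

      D≤Y : D ≤ Y
      D≤Y = m≤n+m D (30 * (k * k))

      N≡64Y³ : N ≡ 64 * (Y * Y * Y)
      N≡64Y³ = refl

      κ²N³≤η : κ * κ * (N * N * N) ≤ η
      κ²N³≤η = ≤-refl

    k≤Y : k ≤ Y
    k≤Y = ≤-trans (m≤m*n k k) (≤-trans (m≤n*m (k * k) 30) 30k²≤Y)

    1≤Y : 1 ≤ Y
    1≤Y = ≤-trans (s≤s z≤n) k≤Y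

    instance
      Y≢0 : NonZero Y
      Y≢0 = >-nonZero 1≤Y

    Y≤Y² : Y ≤ Y * Y
    Y≤Y² = m≤m*n Y Y

    Y≤N : Y ≤ N
    Y≤N = ≤-trans Y≤Y² (≤-trans (m≤m*n (Y * Y) Y)
      (≤-trans (m≤n*m (Y * Y * Y) 64) (≤-reflexive (sym N≡64Y³))))

    1≤N : 1 ≤ N
    1≤N = ≤-trans 1≤Y Y≤N

    instance
      N≢0 : NonZero N
      N≢0 = >-nonZero 1≤N

    module Scales (n : ℕ) (N≤n : N ≤ n) where
      a b c : ℕ
      a = n / k
      b = n / N
      c = 64 * (Y * Y) * b

      1≤b : 1 ≤ b
      1≤b = m≥n⇒m/n>0 N≤n

      Yc≡Nb : Y * c ≡ N * b
      Yc≡Nb = trans (lemma Y b) (cong (_* b) (sym N≡64Y³))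
        where
        lemma : ∀ Y b → Y * (64 * (Y * Y) * b) ≡ 64 * (Y * Y * Y) * b
        lemma = solve-∀

      Yc≤n : Y * c ≤ n
      Yc≤n = ≤-trans (≤-reflexive Yc≡Nb) (n*[m/n]≤m n N)

      n≤2Yc : n ≤ 2 * (Y * c)
      n≤2Yc = begin
        n                        ≤⟨ <⇒≤ (m<n*[1+m/n] n N) ⟩
        N * (1 + b)          ≤⟨ *-monoʳ-≤ N (+-monoˡ-≤ b 1≤b) ⟩
        N * (b + b)          ≡⟨ double N b ⟩
        2 * (N * b)          ≡⟨ cong (2 *_) Yc≡Nb ⟨
        2 * (Y * c)          ∎
        where
        open ≤-Reasoning
        double : ∀ N b → N * (b + b) ≡ 2 * (N * b)
        double = solve-∀

      Y²b≤c : Y * Y * b ≤ c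
      Y²b≤c = *-monoˡ-≤ b (m≤n*m (Y * Y) 64)

      1≤Y² : 1 ≤ Y * Y
      1≤Y² = ≤-trans 1≤Y Y≤Y²

      28Y²b+b≤c : 28 * (Y * Y) * b + b ≤ c
      28Y²b+b≤c = lemma (Y * Y) b 1≤Y²
        where
        lemma : ∀ x b → 1 ≤ x → 28 * x * b + b ≤ 64 * x * b
        lemma x b 1≤x = by-cert (35 * x * b) (b ⊠ 1≤x) (identity x b)
            where
            identity : ∀ x b → 28 * x * b + b + b * x + 35 * x * b ≡ 64 * x * b + b * 1
            identity = solve-∀

      1≤c : 1 ≤ c
      1≤c = ≤-trans (*-mono-≤ 1≤Y² 1≤b) Y²b≤c

      k≤c : k ≤ c
      k≤c = ≤-trans k≤Y (≤-trans Y≤Y² (≤-trans (m≤m*n (Y * Y) b {{>-nonZero 1≤b}}) Y²b≤c))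

      kb≤n : k * b ≤ n
      kb≤n = ≤-trans (*-monoˡ-≤ b (≤-trans k≤Y Y≤N)) (n*[m/n]≤m n N)

      30kc≤a : 30 * (k * c) ≤ a
      30kc≤a = ≤-pred (*-cancelˡ-< k (30 * (k * c)) (1 + a) (begin-strict
        k * (30 * (k * c))   ≡⟨ lemma k c ⟩
        30 * (k * k) * c     ≤⟨ *-monoˡ-≤ c 30k²≤Y ⟩
        Y * c                    ≤⟨ Yc≤n ⟩
        n                          <⟨ m<n*[1+m/n] n k ⟩
        k * (1 + a)            ∎))
        where
        open ≤-Reasoning
        lemma : ∀ k c → k * (30 * (k * c)) ≡ 30 * (k * k) * c
        lemma = solve-∀

      -- Rounding n/k down loses less than `k` after multiplication by `k`, and `c` exceeds `k`
      -- because n ≥ N makes `b` positive.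
      n≤ka+c : n ≤ k * a + c
      n≤ka+c = begin
        n                  ≤⟨ <⇒≤ (m<n*[1+m/n] n k) ⟩
        k * (1 + a)    ≡⟨ trans (*-distribˡ-+ k 1 a) (cong (_+ k * a) (*-identityʳ k)) ⟩
        k + k * a      ≤⟨ +-monoˡ-≤ (k * a) k≤c ⟩
        c + k * a      ≡⟨ +-comm c (k * a) ⟩
        k * a + c      ∎
        where open ≤-Reasoning

      Dc≤n : D * c ≤ n
      Dc≤n = ≤-trans (*-monoˡ-≤ c D≤Y) Yc≤n

      module Graph (H : Graph3 n) (canc : Cancellative H)
        (shadow-large : η * κ * (n * n) ≤ (1 + η) * (k * (shadowSize H * 2)))
        (edges-large : η * κ * (n * n * n) ≤ (1 + η) * (k * k * (size H * 6)))
        where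

        Edge-rotate : ∀ {x y z} → Edge H x y z → Edge H y z x
        Edge-rotate = Any.map λ {e} → Triple-rotate {p = e}

        Edge-swap : ∀ {x y z} → Edge H x y z → Edge H y x z
        Edge-swap = Any.map λ {e} → Triple-swap {p = e}

        open Stability (Edge H) (Edge? H) (Adjacent H) (Adjacent? H) Edge-rotate Edge-swap (Edge⇒Adjacent H)
          (Adjacent-sym H) (cancellative⇒independent H canc) j Y N b c a η 1≤N κ²N³≤η (m<n*[1+m/n] n N) 1≤b 28Y²b+b≤c
          kb≤n n≤2Yc (n*[m/n]≤m n k) (m<n*[1+m/n] n k)
          (≤-trans shadow-large (*-monoʳ-≤ (1 + η) (*-monoʳ-≤ k (shadowSize-≤-Adjacent H))))
          (≤-trans edges-large (*-monoʳ-≤ (1 + η) (*-monoʳ-≤ (k * k) (size-≤-Edge H))))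
          using (W; W?; #W-small; #M-small; #bad-small)

        open Structure (Edge H) (Edge? H) (Adjacent H) (Adjacent? H) W W? Edge-rotate Edge-swap (Edge⇒Adjacent H)
          (Adjacent-sym H) (cancellative⇒independent H canc) k a c (s≤s (s≤s z≤n)) 1≤c 30kc≤a (n*[m/n]≤m n k) n≤ka+c
          #W-small #M-small #bad-small
          using (Good; Good?; Good-swap; Good-swap₂; φ; φ-distinct; φ-unique; φ-exists; few-lost)

        opaque
          partition : Partition H k c
          partition = record
            { Good       = Good
            ; Good?      = Good?
            ; Good-swap  = Good-swap
            ; Good-swap₂ = Good-swap₂
            ; φ          = φ
            ; φ-distinct = φ-distinct
            ; φ-unique   = φ-unique
            ; φ-exists   = φ-exists
            ; few-lost   = few-lost
            }

        open Coloring H partition public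

        lost*D≤n³ : lost * D ≤ n ^ 3
        lost*D≤n³ = begin
          lost * D                    ≤⟨ *-monoˡ-≤ D lost-bound ⟩
          n * (n * c) * D         ≡⟨ lemma n c D ⟩
          n * n * (D * c)         ≤⟨ *-monoʳ-≤ (n * n) Dc≤n ⟩
          n * n * n                 ≡⟨ cube n ⟩
          n ^ 3                         ∎
          where
          open ≤-Reasoning
          lemma : ∀ n c D → n * (n * c) * D ≡ n * n * (D * c)
          lemma = solve-∀
          cube : ∀ n → n * n * n ≡ n * (n * (n * 1))
          cube = solve-∀

        opaque
          stable : Σ (Graph3 k) λ S → IsSTS S × Σ (Graph3 n) λ H′ → SubGraph H′ H ×
            (∃ λ l → size H ≡ size H′ + l × l * D ≤ n ^ 3) × Colorable H′ S
          stable = S , S-isSTS , H′ , H′⊆H , (lost , size-H , lost*D≤n³) , H′-colorable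

open Combinatorics

open import Data.Integer as ℤ using (+_; -[1+_]; +[1+_])
import Data.Integer.Properties as ℤ
import Data.Nat.Properties as ℕ
open import Data.Nat.Tactic.RingSolver using (solve-∀)
open import Data.Rational using (ℚ; mkℚ; 0ℚ; 1ℚ; _<_; _≤_; _+_; _-_; _*_; -_; 1/_; Positive; NonNegative; toℚᵘ)
import Data.Rational as ℚ
import Data.Rational.Properties as ℚ
open import Data.Rational.Unnormalised as ℚᵘ using (ℚᵘ; mkℚᵘ)
import Data.Rational.Unnormalised.Properties as ℚᵘ

-- Rational arithmetic

natᵘ : ℕ → ℚᵘ
natᵘ m = mkℚᵘ (+ m) 0

toℚᵘ-ℕ→ℚ : ∀ m → toℚᵘ (ℕ→ℚ m) ℚᵘ.≃ natᵘ m
toℚᵘ-ℕ→ℚ m = ℚ.toℚᵘ-fromℚᵘ (natᵘ m)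

ℕ→ℚ-+ : ∀ m n → ℕ→ℚ (m ℕ.+ n) ≡ ℕ→ℚ m + ℕ→ℚ n
ℕ→ℚ-+ m n = ℚ.toℚᵘ-injective (begin
  toℚᵘ (ℕ→ℚ (m ℕ.+ n))             ≈⟨ toℚᵘ-ℕ→ℚ (m ℕ.+ n) ⟩
  natᵘ (m ℕ.+ n)                   ≈⟨ ℚᵘ.*≡* (cong (ℤ._* + 1) (sym (cong₂ ℤ._+_
                                        (ℤ.*-identityʳ (+ m)) (ℤ.*-identityʳ (+ n))))) ⟩
  natᵘ m ℚᵘ.+ natᵘ n               ≈⟨ ℚᵘ.+-cong (toℚᵘ-ℕ→ℚ m) (toℚᵘ-ℕ→ℚ n) ⟨
  toℚᵘ (ℕ→ℚ m) ℚᵘ.+ toℚᵘ (ℕ→ℚ n)   ≈⟨ ℚ.toℚᵘ-homo-+ (ℕ→ℚ m) (ℕ→ℚ n) ⟨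
  toℚᵘ (ℕ→ℚ m + ℕ→ℚ n)             ∎)
  where open import Relation.Binary.Reasoning.Setoid ℚᵘ.≃-setoid

ℕ→ℚ-* : ∀ m n → ℕ→ℚ (m ℕ.* n) ≡ ℕ→ℚ m * ℕ→ℚ n
ℕ→ℚ-* m n = ℚ.toℚᵘ-injective (begin
  toℚᵘ (ℕ→ℚ (m ℕ.* n))             ≈⟨ toℚᵘ-ℕ→ℚ (m ℕ.* n) ⟩
  natᵘ (m ℕ.* n)                   ≈⟨ ℚᵘ.*≡* (cong (ℤ._* + 1) (ℤ.pos-* m n)) ⟩
  natᵘ m ℚᵘ.* natᵘ n               ≈⟨ ℚᵘ.*-cong (toℚᵘ-ℕ→ℚ m) (toℚᵘ-ℕ→ℚ n) ⟨
  toℚᵘ (ℕ→ℚ m) ℚᵘ.* toℚᵘ (ℕ→ℚ n)   ≈⟨ ℚ.toℚᵘ-homo-* (ℕ→ℚ m) (ℕ→ℚ n) ⟨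
  toℚᵘ (ℕ→ℚ m * ℕ→ℚ n)             ∎)
  where open import Relation.Binary.Reasoning.Setoid ℚᵘ.≃-setoid

ℕ→ℚ-mono : ∀ {m n} → m ℕ.≤ n → ℕ→ℚ m ≤ ℕ→ℚ n
ℕ→ℚ-mono {m} {n} m≤n = ℚ.toℚᵘ-cancel-≤ (begin
  toℚᵘ (ℕ→ℚ m)  ≃⟨ toℚᵘ-ℕ→ℚ m ⟩
  natᵘ m        ≤⟨ ℚᵘ.*≤* (ℤ.*-monoʳ-≤-nonNeg (+ 1) (ℤ.+≤+ m≤n)) ⟩
  natᵘ n        ≃⟨ toℚᵘ-ℕ→ℚ n ⟨
  toℚᵘ (ℕ→ℚ n)  ∎)
  where open ℚᵘ.≤-Reasoning

ℕ→ℚ-cancel-≤ : ∀ {m n} → ℕ→ℚ m ≤ ℕ→ℚ n → m ℕ.≤ n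
ℕ→ℚ-cancel-≤ {m} {n} p = ℤ.drop‿+≤+ (ℤ.*-cancelʳ-≤-pos (+ m) (+ n) (+ 1) (ℚᵘ.drop-*≤* (begin
  natᵘ m        ≃⟨ toℚᵘ-ℕ→ℚ m ⟨
  toℚᵘ (ℕ→ℚ m)  ≤⟨ ℚ.toℚᵘ-mono-≤ p ⟩
  toℚᵘ (ℕ→ℚ n)  ≃⟨ toℚᵘ-ℕ→ℚ n ⟩
  natᵘ n        ∎)))
  where open ℚᵘ.≤-Reasoning

ℕ→ℚ-nonNeg : ∀ m → NonNegative (ℕ→ℚ m)
ℕ→ℚ-nonNeg m = ℚ.normalize-nonNeg m 1

ℕ→ℚ-pos : ∀ m → Positive (ℕ→ℚ (suc m))
ℕ→ℚ-pos m = ℚ.normalize-pos (suc m) 1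

-- With ε = 1/(1 + η) the factor 1 - ε is η/(1 + η), so multiplying by 1 + η turns the density
-- assumptions into inequalities of natural numbers.
ε-of : ℕ → ℚ
ε-of η = (1/ ℕ→ℚ (suc η)) {{ℚ.pos⇒nonZero (ℕ→ℚ (suc η)) {{ℕ→ℚ-pos η}}}}

ε-pos : ∀ η → 0ℚ < ε-of η
ε-pos η = ℚ.positive⁻¹ (ε-of η) {{ℚ.1/pos⇒pos (ℕ→ℚ (suc η)) {{ℕ→ℚ-pos η}}}}

scale-1-ε : ∀ η → ℕ→ℚ (suc η) * (1ℚ - ε-of η) ≡ ℕ→ℚ η
scale-1-ε η = begin
  E * (1ℚ - ε-of η)            ≡⟨ ℚ.*-distribˡ-+ E 1ℚ (- ε-of η) ⟩
  E * 1ℚ + E * (- ε-of η)      ≡⟨ cong₂ _+_ (ℚ.*-identityʳ E) (sym (ℚ.neg-distribʳ-* E (ε-of η))) ⟩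
  E - E * ε-of η               ≡⟨ cong (λ z → E - z) (ℚ.*-inverseʳ E {{ℚ.pos⇒nonZero E {{ℕ→ℚ-pos η}}}}) ⟩
  E - 1ℚ                       ≡⟨ cong (_- 1ℚ) (trans (cong ℕ→ℚ (sym (ℕ.+-comm η 1))) (ℕ→ℚ-+ η 1)) ⟩
  ℕ→ℚ η + 1ℚ - 1ℚ              ≡⟨ ℚ.+-assoc (ℕ→ℚ η) 1ℚ (- 1ℚ) ⟩
  ℕ→ℚ η + (1ℚ - 1ℚ)            ≡⟨ cong (λ z → ℕ→ℚ η + z) (ℚ.+-inverseʳ 1ℚ) ⟩
  ℕ→ℚ η + 0ℚ                   ≡⟨ ℚ.+-identityʳ (ℕ→ℚ η) ⟩
  ℕ→ℚ η                        ∎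
  where
  open ≡-Reasoning
  E = ℕ→ℚ (suc η)

clear-ε : ∀ η m p q → (1ℚ - ε-of η) * ℕ→ℚ m ≤ ℕ→ℚ p * ℕ→ℚ q → η ℕ.* m ℕ.≤ suc η ℕ.* (p ℕ.* q)
clear-ε η m p q h = ℕ→ℚ-cancel-≤ (begin
  ℕ→ℚ (η ℕ.* m)                                ≡⟨ ℕ→ℚ-* η m ⟩
  ℕ→ℚ η * ℕ→ℚ m                                ≡⟨ cong (_* ℕ→ℚ m) (scale-1-ε η) ⟨
  ℕ→ℚ (suc η) * (1ℚ - ε-of η) * ℕ→ℚ m          ≡⟨ ℚ.*-assoc (ℕ→ℚ (suc η)) (1ℚ - ε-of η) (ℕ→ℚ m) ⟩
  ℕ→ℚ (suc η) * ((1ℚ - ε-of η) * ℕ→ℚ m)        ≤⟨ ℚ.*-monoˡ-≤-nonNeg (ℕ→ℚ (suc η)) {{ℕ→ℚ-nonNeg (suc η)}} h ⟩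
  ℕ→ℚ (suc η) * (ℕ→ℚ p * ℕ→ℚ q)                ≡⟨ cong (ℕ→ℚ (suc η) *_) (ℕ→ℚ-* p q) ⟨
  ℕ→ℚ (suc η) * ℕ→ℚ (p ℕ.* q)                  ≡⟨ ℕ→ℚ-* (suc η) (p ℕ.* q) ⟨
  ℕ→ℚ (suc η ℕ.* (p ℕ.* q))                    ∎)
  where open ℚ.≤-Reasoning

-- The denominator of δ serves as `D`, since multiplying δ by it gives the positive numerator.
archimedean : ∀ δ → 0ℚ < δ → ∃ λ D → 1ℚ ≤ δ * ℕ→ℚ D
archimedean (mkℚ (+ 0) _ _) (ℚ.*<* (ℤ.+<+ ()))
archimedean (mkℚ -[1+ _ ] _ _) (ℚ.*<* ())
archimedean δ@(mkℚ +[1+ p ] q _) _ = suc q , ℚ.toℚᵘ-cancel-≤ (begin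
  toℚᵘ 1ℚ                         ≤⟨ ℚᵘ.*≤* (ℤ.+≤+ nat) ⟩
  mkℚᵘ +[1+ p ] q ℚᵘ.* natᵘ (suc q)  ≃⟨ ℚᵘ.*-congˡ {toℚᵘ δ} (toℚᵘ-ℕ→ℚ (suc q)) ⟨
  toℚᵘ δ ℚᵘ.* toℚᵘ (ℕ→ℚ (suc q))  ≃⟨ ℚ.toℚᵘ-homo-* δ (ℕ→ℚ (suc q)) ⟨
  toℚᵘ (δ * ℕ→ℚ (suc q))          ∎)
  where
  open ℚᵘ.≤-Reasoning
  nat : 1 ℕ.* (suc q ℕ.* 1) ℕ.≤ suc p ℕ.* suc q ℕ.* 1
  nat = ℕ.≤-trans (ℕ.≤-reflexive (ℕ.*-identityˡ (suc q ℕ.* 1))) (ℕ.*-monoˡ-≤ 1 (ℕ.m≤n*m (suc q) (suc p)))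

absorb-δ : ∀ {δ D} → NonNegative δ → 1ℚ ≤ δ * ℕ→ℚ D → ∀ {l m} → l ℕ.* D ℕ.≤ m → ℕ→ℚ l ≤ δ * ℕ→ℚ m
absorb-δ {δ} {D} δ≥0 1≤δD {l} {m} lD≤m = begin
  ℕ→ℚ l                  ≡⟨ ℚ.*-identityʳ (ℕ→ℚ l) ⟨
  ℕ→ℚ l * 1ℚ             ≤⟨ ℚ.*-monoˡ-≤-nonNeg (ℕ→ℚ l) {{ℕ→ℚ-nonNeg l}} 1≤δD ⟩
  ℕ→ℚ l * (δ * ℕ→ℚ D)    ≡⟨ ℚ.*-assoc (ℕ→ℚ l) δ (ℕ→ℚ D) ⟨
  ℕ→ℚ l * δ * ℕ→ℚ D      ≡⟨ cong (_* ℕ→ℚ D) (ℚ.*-comm (ℕ→ℚ l) δ) ⟩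
  δ * ℕ→ℚ l * ℕ→ℚ D      ≡⟨ ℚ.*-assoc δ (ℕ→ℚ l) (ℕ→ℚ D) ⟩
  δ * (ℕ→ℚ l * ℕ→ℚ D)    ≡⟨ cong (δ *_) (ℕ→ℚ-* l D) ⟨
  δ * ℕ→ℚ (l ℕ.* D)      ≤⟨ ℚ.*-monoˡ-≤-nonNeg δ {{δ≥0}} (ℕ→ℚ-mono lD≤m) ⟩
  δ * ℕ→ℚ m              ∎
  where open ℚ.≤-Reasoning

clear-ε-shadow : ∀ η κ k n s → (1ℚ - ε-of η) * ℕ→ℚ (κ ℕ.* n ^ 2) ≤ ℕ→ℚ (2 ℕ.* k) * ℕ→ℚ s →
  η ℕ.* κ ℕ.* (n ℕ.* n) ℕ.≤ (1 ℕ.+ η) ℕ.* (k ℕ.* (s ℕ.* 2))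
clear-ε-shadow η κ k n s p = subst₂ ℕ._≤_ (left η κ n) (right (1 ℕ.+ η) k s) (clear-ε η (κ ℕ.* n ^ 2) (2 ℕ.* k) s p)
  where
  left : ∀ η κ n → η ℕ.* (κ ℕ.* (n ℕ.* (n ℕ.* 1))) ≡ η ℕ.* κ ℕ.* (n ℕ.* n)
  left = solve-∀
  right : ∀ E k s → E ℕ.* (2 ℕ.* k ℕ.* s) ≡ E ℕ.* (k ℕ.* (s ℕ.* 2))
  right = solve-∀

clear-ε-edges : ∀ η κ k n s → (1ℚ - ε-of η) * ℕ→ℚ (κ ℕ.* n ^ 3) ≤ ℕ→ℚ (6 ℕ.* k ^ 2) * ℕ→ℚ s →
  η ℕ.* κ ℕ.* (n ℕ.* n ℕ.* n) ℕ.≤ (1 ℕ.+ η) ℕ.* (k ℕ.* k ℕ.* (s ℕ.* 6))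
clear-ε-edges η κ k n s p = subst₂ ℕ._≤_ (left η κ n) (right (1 ℕ.+ η) k s) (clear-ε η (κ ℕ.* n ^ 3) (6 ℕ.* k ^ 2) s p)
  where
  left : ∀ η κ n → η ℕ.* (κ ℕ.* (n ℕ.* (n ℕ.* (n ℕ.* 1)))) ≡ η ℕ.* κ ℕ.* (n ℕ.* n ℕ.* n)
  left = solve-∀
  right : ∀ E k s → E ℕ.* (6 ℕ.* (k ℕ.* (k ℕ.* 1)) ℕ.* s) ≡ E ℕ.* (k ℕ.* k ℕ.* (s ℕ.* 6))
  right = solve-∀

theorem2p9 : (k : ℕ) → k ≥ 3 → (k % 6 ≡ 1 ⊎ k % 6 ≡ 3) →
    (δ : ℚ) → 0ℚ < δ →
    Σ ℚ λ ε → 0ℚ < ε × Σ ℕ λ n₀ → (n : ℕ) → n ≥ n₀ →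
    (H : Graph3 n) → Cancellative H →
    (1ℚ - ε) * ℕ→ℚ ((k ∸ 1) ℕ.* n ^ 2) ≤ ℕ→ℚ (2 ℕ.* k) * ℕ→ℚ (shadowSize H) →
    (1ℚ - ε) * ℕ→ℚ ((k ∸ 1) ℕ.* n ^ 3) ≤ ℕ→ℚ (6 ℕ.* k ^ 2) * ℕ→ℚ (size H) →
    Σ (Graph3 k) λ S → IsSTS S × Σ (Graph3 n) λ H′ → SubGraph H′ H ×
    ℕ→ℚ (size H) ≤ ℕ→ℚ (size H′) + δ * ℕ→ℚ (n ^ 3) × Colorable H′ S
theorem2p9 (suc zero) (s≤s ()) _ _ _
-- `N` serves as n₀: it makes b = n / N at least 1, which all the rounding estimates rely on.
theorem2p9 (suc (suc j)) _ _ δ 0<δ = ε-of η , ε-pos η , N , λ n N≤n H canc shadow-large edges-large →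
  let S , S-isSTS , H′ , H′⊆H , (l , size-H , lD≤n³) , colorable = Scales.Graph.stable n N≤n H canc
        (clear-ε-shadow η κ k n (shadowSize H) shadow-large) (clear-ε-edges η κ k n (size H) edges-large)
  in S , S-isSTS , H′ , H′⊆H , size-bound H H′ l size-H
    (absorb-δ {δ} {D} (ℚ.nonNegative (ℚ.<⇒≤ 0<δ)) 1≤δD {l} {n ^ 3} lD≤n³) , colorable
  where
  D : ℕ
  D = proj₁ (archimedean δ 0<δ)

  1≤δD : 1ℚ ≤ δ * ℕ→ℚ D
  1≤δD = proj₂ (archimedean δ 0<δ)

  open Main j D

  size-bound : ∀ {n} (H H′ : Graph3 n) l → size H ≡ size H′ ℕ.+ l → ℕ→ℚ l ≤ δ * ℕ→ℚ (n ^ 3) →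
    ℕ→ℚ (size H) ≤ ℕ→ℚ (size H′) + δ * ℕ→ℚ (n ^ 3)
  size-bound {n} H H′ l eq l≤ = begin
    ℕ→ℚ (size H)                        ≡⟨ cong ℕ→ℚ eq ⟩
    ℕ→ℚ (size H′ ℕ.+ l)                 ≡⟨ ℕ→ℚ-+ (size H′) l ⟩
    ℕ→ℚ (size H′) + ℕ→ℚ l               ≤⟨ ℚ.+-monoʳ-≤ (ℕ→ℚ (size H′)) l≤ ⟩
    ℕ→ℚ (size H′) + δ * ℕ→ℚ (n ^ 3)     ∎
    where open ℚ.≤-Reasoning
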